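{- For every fixed integer $k\le -2$, \[ M_k(n)=\frac{n^3}{12(1+2\sqrt2)^2}\bigl(1+o_k(1)\bigr)\qquad(n\to\infty). \]
   Context: For $k\in\mathbb Z$ and $n\ge 1$, $M_k(n)$ is the minimum, over all $2$-colorings $\Delta:[k+1,k+n]\to\{0,1\}$ (where $[a,b]=\{m\in\mathbb Z:a\le m\le b\}$), of the number of triples $(x_1,x_2,x_3)$ with $x_1,x_2,x_3\in[k+1,k+n]$, $x_1\le x_2\le x_3$, $x_1+x_2<x_3$ and $\Delta(x_1)=\Delta(x_2)=\Delta(x_3)$. $o_k(1)$ denotes a quantity tending to $0$ as $n\to\infty$ for fixed $k$. -}

module Defs where

open import Data.Bool using (Bool; true; false; _∧_; if_then_else_)
open import Data.Bool.Properties using () renaming (_≟_ to _≟ᴮ_)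
open import Data.Nat using (ℕ; zero; suc; _⊓_; _≤ᵇ_)
open import Data.Fin using (Fin; toℕ)
open import Data.Vec.Functional using () renaming (_∷_ to _∷ᶠ_)
open import Data.List using (List; []; _∷_; concatMap; map; foldr; length; filter; allFin)
open import Data.Integer as ℤ using (ℤ; +_)
open import Data.Rational as ℚ using (ℚ; _/_)
open import Data.Product using (∃; _×_)
open import Relation.Nullary.Decidable using (⌊_⌋)
open import Relation.Binary.PropositionalEquality using (_≡_)

-- A 2-colouring of [k+1, k+n]; index i : Fin n stands for the integer k + 1 + i.
Colouring : ℕ → Set
Colouring n = Fin n → Bool

elt : ℤ → {n : ℕ} → Fin n → ℤ
elt k i = k ℤ.+ + suc (toℕ i)

isMonoTriple : (k : ℤ) {n : ℕ} → Colouring n → Fin n → Fin n → Fin n → Bool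
isMonoTriple k Δ i j l =
  (toℕ i ≤ᵇ toℕ j) ∧ (toℕ j ≤ᵇ toℕ l)
  ∧ ⌊ (elt k i ℤ.+ elt k j) ℤ.<? elt k l ⌋
  ∧ ⌊ Δ i ≟ᴮ Δ j ⌋ ∧ ⌊ Δ j ≟ᴮ Δ l ⌋

data Triple (n : ℕ) : Set where
  tr : Fin n → Fin n → Fin n → Triple n

allTriples : (n : ℕ) → List (Triple n)
allTriples n =
  concatMap (λ i → concatMap (λ j → map (λ l → tr i j l) (allFin n)) (allFin n)) (allFin n)

countTrue : {A : Set} → (A → Bool) → List A → ℕ
countTrue p [] = 0
countTrue p (x ∷ xs) = if p x then suc (countTrue p xs) else countTrue p xs

monoCount : (k : ℤ) (n : ℕ) → Colouring n → ℕ
monoCount k n Δ = countTrue (λ { (tr i j l) → isMonoTriple k Δ i j l }) (allTriples n)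

allColourings : (n : ℕ) → List (Colouring n)
allColourings zero = (λ ()) ∷ []
allColourings (suc n) =
  concatMap (λ f → (false ∷ᶠ f) ∷ (true ∷ᶠ f) ∷ []) (allColourings n)

-- M_k(n): minimum over all colourings (the all-false colouring is among them,
-- so using its count as the fold's seed does not change the minimum)
M : ℤ → ℕ → ℕ
M k n = foldr _⊓_ (monoCount k n (λ _ → false)) (map (monoCount k n) (allColourings n))

ℕtoℚ : ℕ → ℚ
ℕtoℚ n = + n / 1

den : ℚ → ℚ
den r = ℕtoℚ 12 ℚ.* ((ℚ.1ℚ ℚ.+ ℕtoℚ 2 ℚ.* r) ℚ.* (ℚ.1ℚ ℚ.+ ℕtoℚ 2 ℚ.* r))

-- Dedekind cuts of the real c = 1 / (12 (1 + 2√2)^2), which is decreasing in √2: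
-- q < c  iff  there is a rational r > √2 (r ≥ 0, r² > 2) with q · 12(1+2r)² < 1
BelowC : ℚ → Set
BelowC q = ∃ λ r → (ℚ.0ℚ ℚ.≤ r) × (ℕtoℚ 2 ℚ.< r ℚ.* r) × (q ℚ.* den r ℚ.< ℚ.1ℚ)

-- c < q  iff  there is a rational 0 ≤ r < √2 with q · 12(1+2r)² > 1
AboveC : ℚ → Set
AboveC q = ∃ λ r → (ℚ.0ℚ ℚ.≤ r) × (r ℚ.* r ℚ.< ℕtoℚ 2) × (ℚ.1ℚ ℚ.< q ℚ.* den r)

{-# OPTIONS --safe #-}

-- Up to O(n²) triples the shift k is irrelevant and each unordered triple is counted twice by
-- the ordered ones, so count the ordered monochromatic (i, j, l) with i + j < l.
-- Encode the colouring by signs s with partial sums S and put σ = S n.  Since a triple is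
-- monochromatic exactly when s i s j + s l (s i + s j) = 3, and otherwise the sum is −1, the
-- count is a quadratic form in S; in the variables U = S (n − p) − S p and
-- E = 2σ − S p − S (n − p) it becomes diagonal, and 16 times the count is
-- 2n³/3 + 4 n σ² − Σ_p (3U² + E²) up to O(n²).  As p runs from 0 to n/2, in each step either U or E
-- moves by 2 and the other stays, starting from U = E = σ and ending with U = 0.  A cubic
-- potential shows that the sum of 3U² + E² is largest when E grows first and U is then run down,
-- i.e. for a colouring constant on [0, v) and on [v, n) with n = |σ| + 2v
-- (for 7|σ| < v the potential needs a correction, but there is slack to spare); the count is
-- then at least (v³ + |σ|³)/6 up to O(n²), and Hölder's inequality
-- (|σ| + 2v)³ ≤ (1 + 2√2)² (v³ + |σ|³) finishes the lower bound.  The same colouring with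
-- v = √2 |σ| gives the upper bound.  Throughout, √2 is replaced by a rational p / q on the
-- appropriate side, and 1 + 2√2 by D / q with D = q + 2p.
module Submission where

open import Defs
open import Data.Bool using (Bool; true; false; _∧_; T)
open import Data.Bool.Properties using () renaming (_≟_ to _≟ᴮ_)
open import Data.Fin as Fin using (Fin; toℕ)
open import Data.Integer as ℤ using (ℤ; +_; -[1+_]; ∣_∣; 0ℤ; 1ℤ)
import Data.Integer.Properties as ℤ
import Data.Integer.Tactic.RingSolver as ℤ-Solver
open import Data.List using (List; []; _∷_; _++_; concatMap; map; foldr; tabulate)
open import Data.List.Relation.Unary.Any as Any using (Any; here; there)
open import Data.Nat using (ℕ; zero; suc; _+_; _*_; _∸_; _⊓_; _≤_; _<_; _≥_; _≤ᵇ_; _<ᵇ_; z≤n; s≤s; NonZero; ≢-nonZero)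
open import Data.Nat.Coprimality using (Coprime)
open import Data.Nat.DivMod using (_/_; m≡m%n+[m/n]*n; m%n<n; m/n*n≤m)
open import Data.Nat.Properties
open import Data.Nat.Tactic.RingSolver using (solve-∀)
open import Data.Product using (∃; ∃₂; _×_; _,_)
open import Data.Rational as ℚ using (ℚ; mkℚ)
import Data.Rational.Properties as ℚ
open import Data.Rational.Unnormalised as ℚᵘ using (ℚᵘ; mkℚᵘ; _≃_; *≡*; *<*; *≤*)
import Data.Rational.Unnormalised.Properties as ℚᵘ
open import Data.Sum using (_⊎_; inj₁; inj₂)
open import Data.Unit using (tt)
open import Data.Vec.Functional using () renaming (_∷_ to _∷ᶠ_)
open import Function using (id; _∘_)
open import Relation.Nullary using (yes; no; contradiction)
open import Relation.Nullary.Decidable using (⌊_⌋)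
open import Relation.Binary.PropositionalEquality

-- Finite sums and the counting function

∑ : ℕ → (ℕ → ℕ) → ℕ
∑ zero    f = 0
∑ (suc n) f = f 0 + ∑ n (λ i → f (suc i))

⟦_⟧ : Bool → ℕ
⟦ true ⟧  = 1
⟦ false ⟧ = 0

∑-mono : ∀ n {f g} → (∀ i → i < n → f i ≤ g i) → ∑ n f ≤ ∑ n g
∑-mono zero    h = z≤n
∑-mono (suc n) h = +-mono-≤ (h 0 (s≤s z≤n)) (∑-mono n (λ i i<n → h (suc i) (s≤s i<n)))

∑-cong : ∀ n {f g} → (∀ i → f i ≡ g i) → ∑ n f ≡ ∑ n g
∑-cong zero    h = refl
∑-cong (suc n) h = cong₂ _+_ (h 0) (∑-cong n (λ i → h (suc i)))

∑-+ : ∀ n f g → ∑ n (λ i → f i + g i) ≡ ∑ n f + ∑ n g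
∑-+ zero    f g = refl
∑-+ (suc n) f g rewrite ∑-+ n (λ i → f (suc i)) (λ i → g (suc i)) =
  solve (f 0) (g 0) _ _
  where
  solve : ∀ a b c d → (a + b) + (c + d) ≡ (a + c) + (b + d)
  solve = solve-∀

∑-*ˡ : ∀ n c f → ∑ n (λ i → c * f i) ≡ c * ∑ n f
∑-*ˡ zero    c f = sym (*-zeroʳ c)
∑-*ˡ (suc n) c f rewrite ∑-*ˡ n c (λ i → f (suc i)) = sym (*-distribˡ-+ c (f 0) _)

∑-zero : ∀ n → ∑ n (λ _ → 0) ≡ 0
∑-zero zero    = refl
∑-zero (suc n) = ∑-zero n

∑-swap : ∀ m n (f : ℕ → ℕ → ℕ) → ∑ m (λ i → ∑ n (f i)) ≡ ∑ n (λ j → ∑ m (λ i → f i j))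
∑-swap zero    n f = sym (∑-zero n)
∑-swap (suc m) n f = begin
  ∑ n (f 0) + ∑ m (λ i → ∑ n (f (suc i)))           ≡⟨ cong (λ x → ∑ n (f 0) + x) (∑-swap m n (λ i → f (suc i))) ⟩
  ∑ n (f 0) + ∑ n (λ j → ∑ m (λ i → f (suc i) j))   ≡⟨ ∑-+ n (f 0) _ ⟨
  ∑ n (λ j → f 0 j + ∑ m (λ i → f (suc i) j))       ∎
  where open ≡-Reasoning

∑-last : ∀ n f → ∑ (suc n) f ≡ ∑ n f + f n
∑-last zero    f = +-comm (f 0) 0
∑-last (suc n) f = begin
  f 0 + ∑ (suc n) (λ i → f (suc i))             ≡⟨ cong (λ x → f 0 + x) (∑-last n (λ i → f (suc i))) ⟩
  f 0 + (∑ n (λ i → f (suc i)) + f (suc n))     ≡⟨ +-assoc (f 0) _ _ ⟨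
  f 0 + ∑ n (λ i → f (suc i)) + f (suc n)       ∎
  where open ≡-Reasoning

-- Passing from lists of triples and colourings to sums over indices

countTrue-++ : ∀ {A : Set} (p : A → Bool) xs ys →
  countTrue p (xs ++ ys) ≡ countTrue p xs + countTrue p ys
countTrue-++ p []       ys = refl
countTrue-++ p (x ∷ xs) ys with p x
... | true  = cong suc (countTrue-++ p xs ys)
... | false = countTrue-++ p xs ys

-- Stated for `tabulate g` with arbitrary `g`, since `allFin n` is `tabulate id` and the induction
-- passes to `g ∘ Fin.suc`.
countTrue-map : ∀ {A B : Set} (p : B → Bool) (f : A → B) n (g : Fin n → A) (h : ℕ → ℕ) →
  (∀ i → ⟦ p (f (g i)) ⟧ ≡ h (toℕ i)) → countTrue p (map f (tabulate g)) ≡ ∑ n h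
countTrue-map p f zero    g h e = refl
countTrue-map p f (suc n) g h e with p (f (g Fin.zero)) | e Fin.zero
... | true  | q = cong₂ _+_ q (countTrue-map p f n (g ∘ Fin.suc) (h ∘ suc) (e ∘ Fin.suc))
... | false | q = cong₂ _+_ q (countTrue-map p f n (g ∘ Fin.suc) (h ∘ suc) (e ∘ Fin.suc))

countTrue-concatMap : ∀ {A B : Set} (p : B → Bool) (f : A → List B) n (g : Fin n → A) (h : ℕ → ℕ) →
  (∀ i → countTrue p (f (g i)) ≡ h (toℕ i)) → countTrue p (concatMap f (tabulate g)) ≡ ∑ n h
countTrue-concatMap p f zero    g h e = refl
countTrue-concatMap p f (suc n) g h e =
  trans (countTrue-++ p (f (g Fin.zero)) _)
        (cong₂ _+_ (e Fin.zero) (countTrue-concatMap p f n (g ∘ Fin.suc) (h ∘ suc) (e ∘ Fin.suc)))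

-- A total colouring of ℕ lets the counts be sums over numbers; it continues with the default
-- `false` from n on, and only indices below n are counted.
extend : ∀ {n} → Colouring n → ℕ → Bool
extend {zero}  Δ i       = false
extend {suc n} Δ zero    = Δ Fin.zero
extend {suc n} Δ (suc i) = extend (Δ ∘ Fin.suc) i

extend-toℕ : ∀ {n} (Δ : Colouring n) i → extend Δ (toℕ i) ≡ Δ i
extend-toℕ {suc n} Δ Fin.zero    = refl
extend-toℕ {suc n} Δ (Fin.suc i) = extend-toℕ (Δ ∘ Fin.suc) i

value : ℤ → ℕ → ℤ
value k i = k ℤ.+ + suc i

sameColour : (ℕ → Bool) → ℕ → ℕ → ℕ → Bool
sameColour c i j l = ⌊ c i ≟ᴮ c j ⌋ ∧ ⌊ c j ≟ᴮ c l ⌋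

mono : ℤ → (ℕ → Bool) → ℕ → ℕ → ℕ → Bool
mono k c i j l = (i ≤ᵇ j) ∧ (j ≤ᵇ l) ∧ ⌊ (value k i ℤ.+ value k j) ℤ.<? value k l ⌋ ∧ sameColour c i j l

-- The function `c` is any one that agrees with Δ, because two cases arise: `extend Δ` for a
-- minimiser Δ, and the restriction of a given `c` on ℕ.
monoCount≡∑ : ∀ k n (Δ : Colouring n) (c : ℕ → Bool) → (∀ i → c (toℕ i) ≡ Δ i) →
  monoCount k n Δ ≡ ∑ n (λ i → ∑ n (λ j → ∑ n (λ l → ⟦ mono k c i j l ⟧)))
monoCount≡∑ k n Δ c e =
  countTrue-concatMap _ _ n id _ λ i →
  countTrue-concatMap _ _ n id _ λ j →
  countTrue-map _ _ n id _ λ l → cong ⟦_⟧ (same i j l)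
  where
  same : ∀ i j l → isMonoTriple k Δ i j l ≡ mono k c (toℕ i) (toℕ j) (toℕ l)
  same i j l rewrite e i | e j | e l = refl

-- Completeness is up to pointwise equality, since functions that agree everywhere need not be
-- provably equal; a count sees only the values.
allColourings-complete : ∀ n (Δ : Colouring n) → Any (λ Δ′ → ∀ i → Δ′ i ≡ Δ i) (allColourings n)
allColourings-complete zero    Δ = here λ ()
allColourings-complete (suc n) Δ = go (allColourings-complete n (Δ ∘ Fin.suc))
  where
  go : ∀ {Δs} → Any (λ Δ′ → ∀ i → Δ′ i ≡ Δ (Fin.suc i)) Δs →
       Any (λ Δ′ → ∀ i → Δ′ i ≡ Δ i) (concatMap (λ f → (false ∷ᶠ f) ∷ (true ∷ᶠ f) ∷ []) Δs)
  go (here h) with Δ Fin.zero in eq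
  ... | false = here λ { Fin.zero → sym eq ; (Fin.suc i) → h i }
  ... | true  = there (here λ { Fin.zero → sym eq ; (Fin.suc i) → h i })
  go (there a) = there (there (go a))

-- The seed `f x` is itself a value of `f`, so there is a witness even for the empty list.
foldr-⊓-attained : ∀ {A : Set} (f : A → ℕ) x xs → ∃ λ y → f y ≤ foldr _⊓_ (f x) (map f xs)
foldr-⊓-attained f x []       = x , ≤-refl
foldr-⊓-attained f x (y ∷ xs) with foldr-⊓-attained f x xs | ⊓-sel (f y) (foldr _⊓_ (f x) (map f xs))
... | z , h | inj₁ e = y , ≤-reflexive (sym e)
... | z , h | inj₂ e = z , ≤-trans h (≤-reflexive (sym e))

foldr-⊓-upper : ∀ {A : Set} (f : A → ℕ) b z xs → Any (λ x → f x ≤ b) xs → foldr _⊓_ z (map f xs) ≤ b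
foldr-⊓-upper f b z (x ∷ xs) (here h)  = ≤-trans (m⊓n≤m (f x) _) h
foldr-⊓-upper f b z (x ∷ xs) (there a) = ≤-trans (m⊓n≤n (f x) _) (foldr-⊓-upper f b z xs a)

M-attained : ∀ k n → ∃ λ Δ → monoCount k n Δ ≤ M k n
M-attained k n = foldr-⊓-attained (monoCount k n) (λ _ → false) (allColourings n)

M-upper : ∀ k n (c : ℕ → Bool) → M k n ≤ ∑ n (λ i → ∑ n (λ j → ∑ n (λ l → ⟦ mono k c i j l ⟧)))
M-upper k n c = foldr-⊓-upper (monoCount k n) _ _ (allColourings n)
  (Any.map (λ {Δ} h → ≤-reflexive (monoCount≡∑ k n Δ c (λ i → sym (h i))))
           (allColourings-complete n (λ i → c (toℕ i))))

-- The extremal problem for 3U² + E²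

-- Path τ u v e X records the values u = |U| and e = |E| for a window of τ consecutive elements,
-- together with the sum X of 3U² + E² over it and all the concentric windows inside it; 2v is the
-- number of elements of the window beyond the u that are needed to bring U to 0.  Only an upper
-- bound on the next e is remembered, so a change of sign of U (from ±1 to ∓1) is also a `stay`.
data Path : (τ u v e X : ℕ) → Set where
  even : ∀ {e} → Path 0 0 0 e (e * e)
  odd  : ∀ {e} → Path 1 1 0 e (3 + e * e)
  stay : ∀ {τ u v e e′ X} → Path τ u v e′ X → e′ ≤ e + 2 →
         Path (2 + τ) u (1 + v) e (3 * (u * u) + e * e + X)
  up   : ∀ {τ u v e X} → Path τ (2 + u) v e X →
         Path (2 + τ) u (2 + v) e (3 * (u * u) + e * e + X)
  down : ∀ {τ u v e X} → Path τ u v e X →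
         Path (2 + τ) (2 + u) v e (3 * ((2 + u) * (2 + u)) + e * e + X)

Path-length : ∀ {τ u v e X} → Path τ u v e X → u + 2 * v ≡ τ
Path-length even = refl
Path-length odd  = refl
Path-length (stay {u = u} {v} p _) = trans (lem u v) (cong (λ x → 2 + x) (Path-length p))
  where
  lem : ∀ u v → u + 2 * (1 + v) ≡ 2 + (u + 2 * v)
  lem = solve-∀
Path-length (up {u = u} {v} p) = trans (lem u v) (cong (λ x → 2 + x) (Path-length p))
  where
  lem : ∀ u v → u + 2 * (2 + v) ≡ 2 + (2 + u + 2 * v)
  lem = solve-∀
Path-length (down p) = cong (λ x → 2 + x) (Path-length p)

-- Three times the continuous value of letting E grow from e by 2v, and then U shrink from u to 0.
potential : ℕ → ℕ → ℕ → ℕ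
potential u v e =
  18 * (u * u * v) + 3 * (u * u * u) + 8 * (v * v * v)
  + 6 * (v * e * (2 * v + e)) + 3 * ((e + 2 * v) * (e + 2 * v) * u)

-- The potential loses to the running cost only when |U| grows; K pays for that loss.
record Excess (K Y ε : ℕ) : Set where
  field
    excess : ∀ u v e → ε ≤ e → u + v ≤ Y → 48 * (u * v) ≤ 48 * (v * v + e * v + u * e) + 2 * K
open Excess

-- Discretisation error: 72 Y for each step that shrinks |U|, and the innermost term.
error : ℕ → ℕ → ℕ → ℕ
error Y L τ = 36 * (Y * τ) + (36 + 12 * (L * L))

-- Induction from the innermost window outwards: in each step `potential` must grow by at least the
-- cost 3u² + e² of the new window, up to `K * v` and `error`. As X has one term per two elements,
-- 12 X is compared with twice `potential`. The true e is replaced by any ē ≥ e, because `stay` only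
-- bounds the next value by e + 2. Going inwards, u + v and ē + 2v never increase and ē never
-- decreases, which preserves the side conditions.
Path-bound : ∀ {K Y ε L} → Excess K Y ε → ∀ {τ u v e X} → Path τ u v e X →
  ∀ ē → e ≤ ē → ε ≤ ē → u + v ≤ Y → ē + 2 * v ≤ L →
  12 * X ≤ 2 * potential u v ē + K * v + error Y L τ
Path-bound {K} {Y} {ε} {L} H (even {e}) ē e≤ē _ _ ē≤L = begin
  12 * (e * e)                          ≤⟨ *-monoʳ-≤ 12 (*-mono-≤ e≤L e≤L) ⟩
  12 * (L * L)                          ≤⟨ m≤n+m _ 36 ⟩
  36 + 12 * (L * L)                     ≤⟨ m≤n+m _ (36 * (Y * 0)) ⟩
  error Y L 0                           ≤⟨ m≤n+m _ (2 * potential 0 0 ē + K * 0) ⟩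
  2 * potential 0 0 ē + K * 0 + error Y L 0  ∎
  where
  open ≤-Reasoning
  e≤L : e ≤ L
  e≤L = ≤-trans e≤ē (≤-trans (m≤m+n ē 0) ē≤L)
Path-bound {K} {Y} {ε} {L} H (odd {e}) ē e≤ē _ _ ē≤L = begin
  12 * (3 + e * e)                      ≡⟨ *-distribˡ-+ 12 3 (e * e) ⟩
  36 + 12 * (e * e)                     ≤⟨ +-monoʳ-≤ 36 (*-monoʳ-≤ 12 (*-mono-≤ e≤L e≤L)) ⟩
  36 + 12 * (L * L)                     ≤⟨ m≤n+m _ (36 * (Y * 1)) ⟩
  error Y L 1                           ≤⟨ m≤n+m _ (2 * potential 1 0 ē + K * 0) ⟩
  2 * potential 1 0 ē + K * 0 + error Y L 1  ∎
  where
  open ≤-Reasoning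
  e≤L : e ≤ L
  e≤L = ≤-trans e≤ē (≤-trans (m≤m+n ē 0) ē≤L)
-- This is the motion that `potential` follows: twice its increment is 12 (3u² + ē²) plus the
-- remainder 24 ē + 16.
Path-bound {K} {Y} {ε} {L} H (stay {τ} {u} {v} {e} {e′} {X} p e′≤e+2) ē e≤ē ε≤ē uv≤Y ēv≤L = begin
  12 * (3 * (u * u) + e * e + X)
    ≡⟨ lem₁ (u * u) (e * e) X ⟩
  36 * (u * u) + 12 * (e * e) + 12 * X
    ≤⟨ +-mono-≤ (+-monoʳ-≤ (36 * (u * u)) (*-monoʳ-≤ 12 (*-mono-≤ e≤ē e≤ē)))
         (Path-bound H p (ē + 2) (≤-trans e′≤e+2 (+-monoˡ-≤ 2 e≤ē)) (≤-trans ε≤ē (m≤m+n ē 2))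
           (≤-trans (+-monoʳ-≤ u (n≤1+n v)) uv≤Y) (≤-trans (≤-reflexive (lem₂ ē v)) ēv≤L)) ⟩
  36 * (u * u) + 12 * (ē * ē) + (2 * potential u v (ē + 2) + K * v + error Y L τ)
    ≤⟨ m≤m+n _ (24 * ē + 16 + K + 72 * Y) ⟩
  36 * (u * u) + 12 * (ē * ē) + (2 * potential u v (ē + 2) + K * v + error Y L τ) + (24 * ē + 16 + K + 72 * Y)
    ≡⟨ lem₃ u v ē K Y L τ ⟩
  2 * potential u (1 + v) ē + K * (1 + v) + error Y L (2 + τ) ∎
  where
  open ≤-Reasoning
  lem₁ : ∀ a b X → 12 * (3 * a + b + X) ≡ 36 * a + 12 * b + 12 * X
  lem₁ = solve-∀
  lem₂ : ∀ ē v → ē + 2 + 2 * v ≡ ē + 2 * (1 + v)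
  lem₂ = solve-∀
  lem₃ : ∀ u v ē K Y L τ →
    36 * (u * u) + 12 * (ē * ē)
      + (2 * (18 * (u * u * v) + 3 * (u * u * u) + 8 * (v * v * v)
          + 6 * (v * (ē + 2) * (2 * v + (ē + 2))) + 3 * ((ē + 2 + 2 * v) * (ē + 2 + 2 * v) * u))
        + K * v + (36 * (Y * τ) + (36 + 12 * (L * L)))) + (24 * ē + 16 + K + 72 * Y)
    ≡ 2 * (18 * (u * u * (1 + v)) + 3 * (u * u * u) + 8 * ((1 + v) * (1 + v) * (1 + v))
          + 6 * ((1 + v) * ē * (2 * (1 + v) + ē)) + 3 * ((ē + 2 * (1 + v)) * (ē + 2 * (1 + v)) * u))
      + K * (1 + v) + (36 * (Y * (2 + τ)) + (36 + 12 * (L * L)))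
  lem₃ = solve-∀
-- Twice the increment of `potential` exceeds the cost by 48 (v² + ē v + u ē - u v) to leading
-- order, which may be negative. `excess` bounds the deficit by 2 K, and the term K v pays it since
-- v drops by 2.
Path-bound {K} {Y} {ε} {L} H (up {τ} {u} {v} {e} {X} p) ē e≤ē ε≤ē uv≤Y ēv≤L = +-cancelʳ-≤ (48 * (u * v)) _ _ (begin
  12 * (3 * (u * u) + e * e + X) + 48 * (u * v)
    ≡⟨ lem₁ (u * u) (e * e) X (u * v) ⟩
  36 * (u * u) + 12 * (e * e) + (12 * X + 48 * (u * v))
    ≤⟨ +-mono-≤ (+-monoʳ-≤ (36 * (u * u)) (*-monoʳ-≤ 12 (*-mono-≤ e≤ē e≤ē)))
         (+-mono-≤ (Path-bound H p ē e≤ē ε≤ē (≤-trans (≤-reflexive (lem₂ u v)) uv≤Y)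
                     (≤-trans (+-monoʳ-≤ ē (*-monoʳ-≤ 2 (m≤n+m v 2))) ēv≤L))
                   (excess H u v ē ε≤ē (≤-trans (+-monoʳ-≤ u (m≤n+m v 2)) uv≤Y))) ⟩
  36 * (u * u) + 12 * (ē * ē) + (2 * potential (2 + u) v ē + K * v + error Y L τ + (48 * (v * v + ē * v + u * ē) + 2 * K))
    ≤⟨ m≤m+n _ (48 * v + 24 * u + 96 * ē + 80 + 72 * Y) ⟩
  36 * (u * u) + 12 * (ē * ē) + (2 * potential (2 + u) v ē + K * v + error Y L τ + (48 * (v * v + ē * v + u * ē) + 2 * K))
    + (48 * v + 24 * u + 96 * ē + 80 + 72 * Y)
    ≡⟨ lem₃ u v ē K Y L τ ⟩
  2 * potential u (2 + v) ē + K * (2 + v) + error Y L (2 + τ) + 48 * (u * v) ∎)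
  where
  open ≤-Reasoning
  lem₁ : ∀ a b X c → 12 * (3 * a + b + X) + 48 * c ≡ 36 * a + 12 * b + (12 * X + 48 * c)
  lem₁ = solve-∀
  lem₂ : ∀ u v → 2 + u + v ≡ u + (2 + v)
  lem₂ = solve-∀
  lem₃ : ∀ u v ē K Y L τ →
    36 * (u * u) + 12 * (ē * ē)
      + (2 * (18 * ((2 + u) * (2 + u) * v) + 3 * ((2 + u) * (2 + u) * (2 + u)) + 8 * (v * v * v)
          + 6 * (v * ē * (2 * v + ē)) + 3 * ((ē + 2 * v) * (ē + 2 * v) * (2 + u)))
        + K * v + (36 * (Y * τ) + (36 + 12 * (L * L))) + (48 * (v * v + ē * v + u * ē) + 2 * K))
      + (48 * v + 24 * u + 96 * ē + 80 + 72 * Y)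
    ≡ 2 * (18 * (u * u * (2 + v)) + 3 * (u * u * u) + 8 * ((2 + v) * (2 + v) * (2 + v))
          + 6 * ((2 + v) * ē * (2 * (2 + v) + ē)) + 3 * ((ē + 2 * (2 + v)) * (ē + 2 * (2 + v)) * u))
      + K * (2 + v) + (36 * (Y * (2 + τ)) + (36 + 12 * (L * L))) + 48 * (u * v)
  lem₃ = solve-∀
-- The terms in v are gains. The cube of u contributes 36 (2 + u)² - 72 (2 + u) + 48, which can fall
-- short of the cost; 2 + u ≤ Y bounds the shortfall.
Path-bound {K} {Y} {ε} {L} H (down {τ} {u} {v} {e} {X} p) ē e≤ē ε≤ē uv≤Y ēv≤L = +-cancelʳ-≤ (72 * (2 + u)) _ _ (begin
  12 * (3 * ((2 + u) * (2 + u)) + e * e + X) + 72 * (2 + u)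
    ≡⟨ lem₁ ((2 + u) * (2 + u)) (e * e) X (2 + u) ⟩
  36 * ((2 + u) * (2 + u)) + 12 * (e * e) + (12 * X + 72 * (2 + u))
    ≤⟨ +-mono-≤ (+-monoʳ-≤ (36 * ((2 + u) * (2 + u))) (*-monoʳ-≤ 12 (*-mono-≤ e≤ē e≤ē)))
         (+-mono-≤ (Path-bound H p ē e≤ē ε≤ē (≤-trans (m≤n+m _ 2) uv≤Y) ēv≤L)
                   (*-monoʳ-≤ 72 (≤-trans (m≤m+n (2 + u) v) uv≤Y))) ⟩
  36 * ((2 + u) * (2 + u)) + 12 * (ē * ē) + (2 * potential u v ē + K * v + error Y L τ + 72 * Y)
    ≤⟨ m≤m+n _ (144 * (v * (1 + u)) + 48 * (ē * v) + 48 * (v * v) + 48) ⟩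
  36 * ((2 + u) * (2 + u)) + 12 * (ē * ē) + (2 * potential u v ē + K * v + error Y L τ + 72 * Y)
    + (144 * (v * (1 + u)) + 48 * (ē * v) + 48 * (v * v) + 48)
    ≡⟨ lem₃ u v ē K Y L τ ⟩
  2 * potential (2 + u) v ē + K * v + error Y L (2 + τ) + 72 * (2 + u) ∎)
  where
  open ≤-Reasoning
  lem₁ : ∀ a b X c → 12 * (3 * a + b + X) + 72 * c ≡ 36 * a + 12 * b + (12 * X + 72 * c)
  lem₁ = solve-∀
  lem₃ : ∀ u v ē K Y L τ →
    36 * ((2 + u) * (2 + u)) + 12 * (ē * ē)
      + (2 * (18 * (u * u * v) + 3 * (u * u * u) + 8 * (v * v * v)
          + 6 * (v * ē * (2 * v + ē)) + 3 * ((ē + 2 * v) * (ē + 2 * v) * u))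
        + K * v + (36 * (Y * τ) + (36 + 12 * (L * L))) + 72 * Y)
      + (144 * (v * (1 + u)) + 48 * (ē * v) + 48 * (v * v) + 48)
    ≡ 2 * (18 * ((2 + u) * (2 + u) * v) + 3 * ((2 + u) * (2 + u) * (2 + u)) + 8 * (v * v * v)
          + 6 * (v * ē * (2 * v + ē)) + 3 * ((ē + 2 * v) * (ē + 2 * v) * (2 + u)))
      + K * v + (36 * (Y * (2 + τ)) + (36 + 12 * (L * L))) + 72 * (2 + u)
  lem₃ = solve-∀

-- Sums over antidiagonals

diag : ℕ → (ℕ → ℕ → ℕ) → ℕ
diag zero    f = f 0 0
diag (suc n) f = f 0 (suc n) + diag n (λ i j → f (suc i) j)

diagᶻ : ℕ → (ℕ → ℕ → ℤ) → ℤ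
diagᶻ zero    f = f 0 0
diagᶻ (suc n) f = f 0 (suc n) ℤ.+ diagᶻ n (λ i j → f (suc i) j)

-- Recursion at the last index makes S (i + 1) = S i + s i hold by computation for the prefix sums S
-- = `∑ᶻ s`.
∑ᶻ : (ℕ → ℤ) → ℕ → ℤ
∑ᶻ f zero    = 0ℤ
∑ᶻ f (suc n) = ∑ᶻ f n ℤ.+ f n

diagᶻ-cong : ∀ n {f g} → (∀ i j → f i j ≡ g i j) → diagᶻ n f ≡ diagᶻ n g
diagᶻ-cong zero    h = h 0 0
diagᶻ-cong (suc n) h = cong₂ ℤ._+_ (h 0 (suc n)) (diagᶻ-cong n (λ i j → h (suc i) j))

interchange : ∀ a b c d → (a ℤ.+ b) ℤ.+ (c ℤ.+ d) ≡ (a ℤ.+ c) ℤ.+ (b ℤ.+ d)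
interchange = ℤ-Solver.solve-∀

diagᶻ-+ : ∀ n f g → diagᶻ n (λ i j → f i j ℤ.+ g i j) ≡ diagᶻ n f ℤ.+ diagᶻ n g
diagᶻ-+ zero    f g = refl
diagᶻ-+ (suc n) f g =
  trans (cong (λ x → f 0 (suc n) ℤ.+ g 0 (suc n) ℤ.+ x) (diagᶻ-+ n (λ i j → f (suc i) j) (λ i j → g (suc i) j)))
        (interchange (f 0 (suc n)) (g 0 (suc n)) _ _)

diagᶻ-*ˡ : ∀ n c f → diagᶻ n (λ i j → c ℤ.* f i j) ≡ c ℤ.* diagᶻ n f
diagᶻ-*ˡ zero    c f = refl
diagᶻ-*ˡ (suc n) c f =
  trans (cong (λ x → c ℤ.* f 0 (suc n) ℤ.+ x) (diagᶻ-*ˡ n c (λ i j → f (suc i) j)))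
        (sym (ℤ.*-distribˡ-+ c _ _))

-- Together with the defining equation it removes both ends of an antidiagonal, which is how
-- concentric windows are peeled.
diagᶻ-last : ∀ n f → diagᶻ (suc n) f ≡ diagᶻ n (λ i j → f i (suc j)) ℤ.+ f (suc n) 0
diagᶻ-last zero    f = refl
diagᶻ-last (suc n) f =
  trans (cong (λ x → f 0 (suc (suc n)) ℤ.+ x) (diagᶻ-last n (λ i j → f (suc i) j)))
        (sym (ℤ.+-assoc (f 0 (suc (suc n))) _ _))

diagᶻ-const : ∀ n c → diagᶻ n (λ _ _ → c) ≡ + suc n ℤ.* c
diagᶻ-const zero    c = sym (ℤ.*-identityˡ c)
diagᶻ-const (suc n) c = trans (cong (λ x → c ℤ.+ x) (diagᶻ-const n c)) (sym (ℤ.suc-* (+ suc n) c))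

diagᶻ-fst : ∀ (f : ℕ → ℤ) n → diagᶻ n (λ i _ → f i) ≡ ∑ᶻ f (suc n)
diagᶻ-fst f zero    = sym (ℤ.+-identityˡ (f 0))
diagᶻ-fst f (suc n) = trans (diagᶻ-last n (λ i _ → f i)) (cong (λ x → x ℤ.+ f (suc n)) (diagᶻ-fst f n))

diagᶻ-snd : ∀ (f : ℕ → ℤ) n → diagᶻ n (λ _ j → f j) ≡ ∑ᶻ f (suc n)
diagᶻ-snd f zero    = sym (ℤ.+-identityˡ (f 0))
diagᶻ-snd f (suc n) = trans (cong (λ x → f (suc n) ℤ.+ x) (diagᶻ-snd f n)) (ℤ.+-comm (f (suc n)) _)

∑ᶻ-scaled : ∀ n c (f : ℕ → ℕ) g → (∀ i → c ℤ.* + f i ≡ g i) → c ℤ.* + ∑ n f ≡ ∑ᶻ g n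
∑ᶻ-scaled zero    c f g h = ℤ.*-zeroʳ c
∑ᶻ-scaled (suc n) c f g h = begin
  c ℤ.* + ∑ (suc n) f                ≡⟨ cong (λ x → c ℤ.* + x) (∑-last n f) ⟩
  c ℤ.* (+ ∑ n f ℤ.+ + f n)          ≡⟨ ℤ.*-distribˡ-+ c (+ ∑ n f) (+ f n) ⟩
  c ℤ.* + ∑ n f ℤ.+ c ℤ.* + f n      ≡⟨ cong₂ ℤ._+_ (∑ᶻ-scaled n c f g h) (h n) ⟩
  ∑ᶻ g n ℤ.+ g n                     ∎
  where open ≡-Reasoning

diagᶻ-scaled : ∀ n c (f : ℕ → ℕ → ℕ) g → (∀ i j → c ℤ.* + f i j ≡ g i j) → c ℤ.* + diag n f ≡ diagᶻ n g
diagᶻ-scaled zero    c f g h = h 0 0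
diagᶻ-scaled (suc n) c f g h = begin
  c ℤ.* (+ f 0 (suc n) ℤ.+ + diag n f′)           ≡⟨ ℤ.*-distribˡ-+ c (+ f 0 (suc n)) (+ diag n f′) ⟩
  c ℤ.* + f 0 (suc n) ℤ.+ c ℤ.* + diag n f′       ≡⟨ cong₂ ℤ._+_ (h 0 (suc n)) (diagᶻ-scaled n c f′ _ (λ i j → h (suc i) j)) ⟩
  g 0 (suc n) ℤ.+ diagᶻ n (λ i j → g (suc i) j)   ∎
  where
  open ≡-Reasoning
  f′ = λ i j → f (suc i) j

-- In generating functions, prefix summation is multiplication by x / (1 - x), so it can be moved
-- from one factor of a convolution to the whole.
diagᶻ-prefix : ∀ s n →
  diagᶻ n (λ i j → s i ℤ.* ∑ᶻ s j) ≡ ∑ᶻ (λ t → diagᶻ t (λ i j → s i ℤ.* s j)) n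
diagᶻ-prefix s zero    = ℤ.*-zeroʳ (s 0)
diagᶻ-prefix s (suc n) = begin
  diagᶻ (suc n) (λ i j → s i ℤ.* ∑ᶻ s j)
    ≡⟨ diagᶻ-last n (λ i j → s i ℤ.* ∑ᶻ s j) ⟩
  diagᶻ n (λ i j → s i ℤ.* (∑ᶻ s j ℤ.+ s j)) ℤ.+ s (suc n) ℤ.* 0ℤ
    ≡⟨ cong₂ ℤ._+_ (diagᶻ-cong n (λ i j → ℤ.*-distribˡ-+ (s i) (∑ᶻ s j) (s j))) (ℤ.*-zeroʳ (s (suc n))) ⟩
  diagᶻ n (λ i j → s i ℤ.* ∑ᶻ s j ℤ.+ s i ℤ.* s j) ℤ.+ 0ℤ
    ≡⟨ ℤ.+-identityʳ _ ⟩
  diagᶻ n (λ i j → s i ℤ.* ∑ᶻ s j ℤ.+ s i ℤ.* s j)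
    ≡⟨ diagᶻ-+ n _ _ ⟩
  diagᶻ n (λ i j → s i ℤ.* ∑ᶻ s j) ℤ.+ diagᶻ n (λ i j → s i ℤ.* s j)
    ≡⟨ cong (λ x → x ℤ.+ diagᶻ n (λ i j → s i ℤ.* s j)) (diagᶻ-prefix s n) ⟩
  ∑ᶻ (λ t → diagᶻ t (λ i j → s i ℤ.* s j)) n ℤ.+ diagᶻ n (λ i j → s i ℤ.* s j) ∎
  where open ≡-Reasoning

-- Both factors are summed here, so two prefix summations move outside.
diagᶻ-prefix² : ∀ s n →
  diagᶻ n (λ i j → ∑ᶻ s i ℤ.* ∑ᶻ s j) ≡ ∑ᶻ (λ l → ∑ᶻ (λ t → diagᶻ t (λ i j → s i ℤ.* s j)) l) n
diagᶻ-prefix² s zero    = refl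
diagᶻ-prefix² s (suc n) = begin
  0ℤ ℤ.* ∑ᶻ s (suc n) ℤ.+ diagᶻ n (λ i j → (∑ᶻ s i ℤ.+ s i) ℤ.* ∑ᶻ s j)
    ≡⟨ cong₂ ℤ._+_ (ℤ.*-zeroˡ (∑ᶻ s (suc n))) (diagᶻ-cong n (λ i j → ℤ.*-distribʳ-+ (∑ᶻ s j) (∑ᶻ s i) (s i))) ⟩
  0ℤ ℤ.+ diagᶻ n (λ i j → ∑ᶻ s i ℤ.* ∑ᶻ s j ℤ.+ s i ℤ.* ∑ᶻ s j)
    ≡⟨ ℤ.+-identityˡ _ ⟩
  diagᶻ n (λ i j → ∑ᶻ s i ℤ.* ∑ᶻ s j ℤ.+ s i ℤ.* ∑ᶻ s j)
    ≡⟨ diagᶻ-+ n _ _ ⟩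
  diagᶻ n (λ i j → ∑ᶻ s i ℤ.* ∑ᶻ s j) ℤ.+ diagᶻ n (λ i j → s i ℤ.* ∑ᶻ s j)
    ≡⟨ cong₂ ℤ._+_ (diagᶻ-prefix² s n) (diagᶻ-prefix s n) ⟩
  ∑ᶻ (λ l → ∑ᶻ (λ t → diagᶻ t (λ i j → s i ℤ.* s j)) l) (suc n) ∎
  where open ≡-Reasoning

-- The count as a quadratic form in the partial sums

tetrahedral : ℕ → ℤ
tetrahedral = ∑ᶻ (λ l → ∑ᶻ (λ t → + suc t) l)

triangular-closed : ∀ n → + 2 ℤ.* ∑ᶻ (λ t → + suc t) n ≡ + n ℤ.* (+ n ℤ.+ 1ℤ)
triangular-closed zero    = refl
triangular-closed (suc n) =
  trans (ℤ.*-distribˡ-+ (+ 2) (∑ᶻ (λ t → + suc t) n) (+ suc n))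
  (trans (cong (λ x → x ℤ.+ + 2 ℤ.* + suc n) (triangular-closed n)) (lem (+ n)))
  where
  lem : ∀ n → n ℤ.* (n ℤ.+ 1ℤ) ℤ.+ + 2 ℤ.* (1ℤ ℤ.+ n) ≡ (1ℤ ℤ.+ n) ℤ.* (1ℤ ℤ.+ n ℤ.+ 1ℤ)
  lem = ℤ-Solver.solve-∀

-- `tetrahedral n` is the number of all (i, j, l) with i + j < l < n, the binomial coefficient of n
-- + 1 over 3.
tetrahedral-closed : ∀ n → + 6 ℤ.* tetrahedral n ≡ + n ℤ.* + n ℤ.* + n ℤ.- + n
tetrahedral-closed zero    = refl
tetrahedral-closed (suc n) = begin
  + 6 ℤ.* (tetrahedral n ℤ.+ t)                           ≡⟨ lem₁ (tetrahedral n) t ⟩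
  + 6 ℤ.* tetrahedral n ℤ.+ + 3 ℤ.* (+ 2 ℤ.* t)           ≡⟨ cong₂ (λ x y → x ℤ.+ + 3 ℤ.* y) (tetrahedral-closed n) (triangular-closed n) ⟩
  + n ℤ.* + n ℤ.* + n ℤ.- + n ℤ.+ + 3 ℤ.* (+ n ℤ.* (+ n ℤ.+ 1ℤ)) ≡⟨ lem₂ (+ n) ⟩
  + suc n ℤ.* + suc n ℤ.* + suc n ℤ.- + suc n             ∎
  where
  open ≡-Reasoning
  t = ∑ᶻ (λ t → + suc t) n
  lem₁ : ∀ a t → + 6 ℤ.* (a ℤ.+ t) ≡ + 6 ℤ.* a ℤ.+ + 3 ℤ.* (+ 2 ℤ.* t)
  lem₁ = ℤ-Solver.solve-∀
  lem₂ : ∀ n → n ℤ.* n ℤ.* n ℤ.- n ℤ.+ + 3 ℤ.* (n ℤ.* (n ℤ.+ 1ℤ)) ≡ (1ℤ ℤ.+ n) ℤ.* (1ℤ ℤ.+ n) ℤ.* (1ℤ ℤ.+ n) ℤ.- (1ℤ ℤ.+ n)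
  lem₂ = ℤ-Solver.solve-∀

prefixSum : (ℕ → ℤ) → ℕ → ℤ
prefixSum s n = ∑ᶻ (λ t → ∑ᶻ s (suc t)) n

prefixSquares : (ℕ → ℤ) → ℕ → ℤ
prefixSquares s n = ∑ᶻ (λ t → ∑ᶻ s (suc t) ℤ.* ∑ᶻ s (suc t)) n

-- For signs ±1 the summand is 4 on a monochromatic triple and 0 on every other one.
tripleForm : (ℕ → ℤ) → ℕ → ℤ
tripleForm s n = ∑ᶻ (λ l → ∑ᶻ (λ t → diagᶻ t (λ i j → 1ℤ ℤ.+ s i ℤ.* s j ℤ.+ s l ℤ.* (s i ℤ.+ s j))) l) n

-- The products s i · s j give a double prefix sum of a convolution. For s l · (s i + s j), the
-- antidiagonal t contributes 2 S (t + 1), and exchanging the sums over t and l leaves 2 S (t + 1) ·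
-- (σ - S (t + 1)) for each t.
tripleForm-closed : ∀ s n → tripleForm s n ≡
  tetrahedral n ℤ.+ diagᶻ n (λ i j → ∑ᶻ s i ℤ.* ∑ᶻ s j)
  ℤ.+ + 2 ℤ.* (∑ᶻ s n ℤ.* prefixSum s n ℤ.- prefixSquares s n)
tripleForm-closed s n = trans (go n) (cong (λ x → tetrahedral n ℤ.+ x ℤ.+ + 2 ℤ.* (∑ᶻ s n ℤ.* prefixSum s n ℤ.- prefixSquares s n)) (sym (diagᶻ-prefix² s n)))
  where
  open ≡-Reasoning
  pairs : ℕ → ℤ
  pairs t = diagᶻ t (λ i j → s i ℤ.* s j)
  onDiag : ∀ x t → diagᶻ t (λ i j → 1ℤ ℤ.+ s i ℤ.* s j ℤ.+ x ℤ.* (s i ℤ.+ s j))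
                 ≡ + suc t ℤ.+ pairs t ℤ.+ x ℤ.* (∑ᶻ s (suc t) ℤ.+ ∑ᶻ s (suc t))
  onDiag x t = begin
    diagᶻ t (λ i j → 1ℤ ℤ.+ s i ℤ.* s j ℤ.+ x ℤ.* (s i ℤ.+ s j))
      ≡⟨ diagᶻ-+ t _ _ ⟩
    diagᶻ t (λ i j → 1ℤ ℤ.+ s i ℤ.* s j) ℤ.+ diagᶻ t (λ i j → x ℤ.* (s i ℤ.+ s j))
      ≡⟨ cong₂ ℤ._+_ (diagᶻ-+ t _ _) (diagᶻ-*ˡ t x _) ⟩
    diagᶻ t (λ _ _ → 1ℤ) ℤ.+ pairs t ℤ.+ x ℤ.* diagᶻ t (λ i j → s i ℤ.+ s j)
      ≡⟨ cong₂ (λ y z → y ℤ.+ pairs t ℤ.+ x ℤ.* z) (trans (diagᶻ-const t 1ℤ) (ℤ.*-identityʳ (+ suc t)))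
               (trans (diagᶻ-+ t _ _) (cong₂ ℤ._+_ (diagᶻ-fst s t) (diagᶻ-snd s t))) ⟩
    + suc t ℤ.+ pairs t ℤ.+ x ℤ.* (∑ᶻ s (suc t) ℤ.+ ∑ᶻ s (suc t)) ∎
  onTriangle : ∀ x l → ∑ᶻ (λ t → diagᶻ t (λ i j → 1ℤ ℤ.+ s i ℤ.* s j ℤ.+ x ℤ.* (s i ℤ.+ s j))) l
                     ≡ ∑ᶻ (λ t → + suc t) l ℤ.+ ∑ᶻ pairs l ℤ.+ + 2 ℤ.* (x ℤ.* prefixSum s l)
  onTriangle x zero    = sym (cong (λ y → 0ℤ ℤ.+ 0ℤ ℤ.+ + 2 ℤ.* y) (ℤ.*-zeroʳ x))
  onTriangle x (suc l) = trans (cong₂ ℤ._+_ (onTriangle x l) (onDiag x l))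
    (lem x (∑ᶻ (λ t → + suc t) l) (∑ᶻ pairs l) (prefixSum s l) (+ suc l) (pairs l) (∑ᶻ s (suc l)))
    where
    lem : ∀ x a b c d e f → (a ℤ.+ b ℤ.+ + 2 ℤ.* (x ℤ.* c)) ℤ.+ (d ℤ.+ e ℤ.+ x ℤ.* (f ℤ.+ f))
                          ≡ (a ℤ.+ d) ℤ.+ (b ℤ.+ e) ℤ.+ + 2 ℤ.* (x ℤ.* (c ℤ.+ f))
    lem = ℤ-Solver.solve-∀
  go : ∀ n → tripleForm s n ≡ tetrahedral n ℤ.+ ∑ᶻ (∑ᶻ pairs) n
                              ℤ.+ + 2 ℤ.* (∑ᶻ s n ℤ.* prefixSum s n ℤ.- prefixSquares s n)
  go zero    = refl
  go (suc n) = trans (cong₂ ℤ._+_ (go n) (onTriangle (s n) n))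
    (lem (s n) (tetrahedral n) (∑ᶻ (∑ᶻ pairs) n) (∑ᶻ s n) (prefixSum s n) (prefixSquares s n) (∑ᶻ (λ t → + suc t) n) (∑ᶻ pairs n))
    where
    lem : ∀ x T P S Z Q t p →
      (T ℤ.+ P ℤ.+ + 2 ℤ.* (S ℤ.* Z ℤ.- Q)) ℤ.+ (t ℤ.+ p ℤ.+ + 2 ℤ.* (x ℤ.* Z))
      ≡ (T ℤ.+ t) ℤ.+ (P ℤ.+ p) ℤ.+ + 2 ℤ.* ((S ℤ.+ x) ℤ.* (Z ℤ.+ (S ℤ.+ x)) ℤ.- (Q ℤ.+ (S ℤ.+ x) ℤ.* (S ℤ.+ x)))
    lem = ℤ-Solver.solve-∀

-- This is 3U² + E² for a = S p and b = S (n - p).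
weight : ℤ → ℤ → ℤ → ℤ
weight σ a b = + 3 ℤ.* ((b ℤ.- a) ℤ.* (b ℤ.- a)) ℤ.+ (+ 2 ℤ.* σ ℤ.- a ℤ.- b) ℤ.* (+ 2 ℤ.* σ ℤ.- a ℤ.- b)

-- Expanded, `weight σ a b` is 4 (σ² - a b + a² + b² - σ (a + b)). Summed over the antidiagonal, the
-- products a b give the convolution, and the other terms give `prefixSquares` and `prefixSum` twice
-- each.
tripleForm-weight : ∀ s n → let σ = ∑ᶻ s n in
  + 4 ℤ.* tripleForm s n ≡
  + 4 ℤ.* tetrahedral n ℤ.+ + suc n ℤ.* (+ 4 ℤ.* (σ ℤ.* σ)) ℤ.- diagᶻ n (λ i j → weight σ (∑ᶻ s i) (∑ᶻ s j))
tripleForm-weight s n = begin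
  + 4 ℤ.* tripleForm s n
    ≡⟨ cong (λ x → + 4 ℤ.* x) (tripleForm-closed s n) ⟩
  + 4 ℤ.* (tetrahedral n ℤ.+ SS ℤ.+ + 2 ℤ.* (σ ℤ.* Z ℤ.- Q))
    ≡⟨ lem (tetrahedral n) SS σ Z Q (+ suc n) ⟩
  + 4 ℤ.* tetrahedral n ℤ.+ + suc n ℤ.* (+ 4 ℤ.* (σ ℤ.* σ)) ℤ.-
    (+ suc n ℤ.* (+ 4 ℤ.* (σ ℤ.* σ)) ℤ.+ (ℤ.- + 4) ℤ.* SS ℤ.+ + 4 ℤ.* (Q ℤ.+ Q) ℤ.+ (ℤ.- + 4 ℤ.* σ) ℤ.* (Z ℤ.+ Z))
    ≡⟨ cong (λ x → + 4 ℤ.* tetrahedral n ℤ.+ + suc n ℤ.* (+ 4 ℤ.* (σ ℤ.* σ)) ℤ.- x) (sym expand) ⟩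
  + 4 ℤ.* tetrahedral n ℤ.+ + suc n ℤ.* (+ 4 ℤ.* (σ ℤ.* σ)) ℤ.- diagᶻ n (λ i j → weight σ (S i) (S j)) ∎
  where
  open ≡-Reasoning
  S = ∑ᶻ s
  σ = S n
  Z = prefixSum s n
  Q = prefixSquares s n
  SS = diagᶻ n (λ i j → S i ℤ.* S j)
  lem : ∀ T P σ Z Q m → + 4 ℤ.* (T ℤ.+ P ℤ.+ + 2 ℤ.* (σ ℤ.* Z ℤ.- Q)) ≡
    + 4 ℤ.* T ℤ.+ m ℤ.* (+ 4 ℤ.* (σ ℤ.* σ)) ℤ.-
    (m ℤ.* (+ 4 ℤ.* (σ ℤ.* σ)) ℤ.+ (ℤ.- + 4) ℤ.* P ℤ.+ + 4 ℤ.* (Q ℤ.+ Q) ℤ.+ (ℤ.- + 4 ℤ.* σ) ℤ.* (Z ℤ.+ Z))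
  lem = ℤ-Solver.solve-∀
  polar : ∀ σ a b → weight σ a b ≡
    + 4 ℤ.* (σ ℤ.* σ) ℤ.+ (ℤ.- + 4) ℤ.* (a ℤ.* b) ℤ.+ + 4 ℤ.* (a ℤ.* a ℤ.+ b ℤ.* b) ℤ.+ (ℤ.- + 4 ℤ.* σ) ℤ.* (a ℤ.+ b)
  polar = unfolded
    where
    unfolded : ∀ σ a b → + 3 ℤ.* ((b ℤ.- a) ℤ.* (b ℤ.- a)) ℤ.+ (+ 2 ℤ.* σ ℤ.- a ℤ.- b) ℤ.* (+ 2 ℤ.* σ ℤ.- a ℤ.- b) ≡
      + 4 ℤ.* (σ ℤ.* σ) ℤ.+ (ℤ.- + 4) ℤ.* (a ℤ.* b) ℤ.+ + 4 ℤ.* (a ℤ.* a ℤ.+ b ℤ.* b) ℤ.+ (ℤ.- + 4 ℤ.* σ) ℤ.* (a ℤ.+ b)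
    unfolded = ℤ-Solver.solve-∀
  -- Since S 0 = 0, the n + 1 terms of an antidiagonal reduce to the n terms of `prefixSum` and
  -- `prefixSquares`.
  shift : ∀ (f : ℕ → ℤ) n → f 0 ≡ 0ℤ → ∑ᶻ f (suc n) ≡ ∑ᶻ (λ t → f (suc t)) n
  shift f zero    h = trans (ℤ.+-identityˡ (f 0)) h
  shift f (suc n) h = cong (λ x → x ℤ.+ f (suc n)) (shift f n h)
  expand : diagᶻ n (λ i j → weight σ (S i) (S j)) ≡
    + suc n ℤ.* (+ 4 ℤ.* (σ ℤ.* σ)) ℤ.+ (ℤ.- + 4) ℤ.* SS ℤ.+ + 4 ℤ.* (Q ℤ.+ Q) ℤ.+ (ℤ.- + 4 ℤ.* σ) ℤ.* (Z ℤ.+ Z)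
  expand =
    trans (diagᶻ-cong n (λ i j → polar σ (S i) (S j)))
    (trans (diagᶻ-+ n _ _) (cong₂ ℤ._+_
      (trans (diagᶻ-+ n _ _) (cong₂ ℤ._+_
        (trans (diagᶻ-+ n _ _) (cong₂ ℤ._+_ (diagᶻ-const n (+ 4 ℤ.* (σ ℤ.* σ))) (diagᶻ-*ˡ n (ℤ.- + 4) (λ i j → S i ℤ.* S j))))
        (trans (diagᶻ-*ˡ n (+ 4) _) (cong (λ x → + 4 ℤ.* x) (trans (diagᶻ-+ n _ _)
          (cong₂ ℤ._+_ (trans (diagᶻ-fst (λ i → S i ℤ.* S i) n) (shift _ n refl))
                       (trans (diagᶻ-snd (λ i → S i ℤ.* S i) n) (shift _ n refl))))))))
      (trans (diagᶻ-*ˡ n (ℤ.- + 4 ℤ.* σ) _) (cong (λ x → (ℤ.- + 4 ℤ.* σ) ℤ.* x) (trans (diagᶻ-+ n _ _)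
          (cong₂ ℤ._+_ (trans (diagᶻ-fst S n) (shift S n refl))
                       (trans (diagᶻ-snd S n) (shift S n refl))))))))

+∣i∣*∣i∣ : ∀ i → + (∣ i ∣ * ∣ i ∣) ≡ i ℤ.* i
+∣i∣*∣i∣ (+ n)      = ℤ.pos-* n n
+∣i∣*∣i∣ (-[1+ n ]) = refl

weight-abs : ∀ σ a b → let u = ∣ b ℤ.- a ∣ ; e = ∣ + 2 ℤ.* σ ℤ.- a ℤ.- b ∣ in
  weight σ a b ≡ + (3 * (u * u) + e * e)
weight-abs σ a b = sym (cong₂ ℤ._+_
  (trans (ℤ.pos-* 3 (∣ b ℤ.- a ∣ * ∣ b ℤ.- a ∣)) (cong (λ x → + 3 ℤ.* x) (+∣i∣*∣i∣ (b ℤ.- a))))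
  (+∣i∣*∣i∣ (+ 2 ℤ.* σ ℤ.- a ℤ.- b)))

weight-sym : ∀ σ a b → weight σ b a ≡ weight σ a b
weight-sym = unfolded
  where
  unfolded : ∀ σ a b → + 3 ℤ.* ((a ℤ.- b) ℤ.* (a ℤ.- b)) ℤ.+ (+ 2 ℤ.* σ ℤ.- b ℤ.- a) ℤ.* (+ 2 ℤ.* σ ℤ.- b ℤ.- a)
    ≡ + 3 ℤ.* ((b ℤ.- a) ℤ.* (b ℤ.- a)) ℤ.+ (+ 2 ℤ.* σ ℤ.- a ℤ.- b) ℤ.* (+ 2 ℤ.* σ ℤ.- a ℤ.- b)
  unfolded = ℤ-Solver.solve-∀

-- From partial sums to a `Path`

UnitSteps : (ℕ → ℤ) → Set
UnitSteps A = ∀ i → A (suc i) ≡ A i ℤ.+ 1ℤ ⊎ A (suc i) ≡ A i ℤ.- 1ℤ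

-- The possible changes of |i| when i moves by 2; `cross` is the passage between -1 and 1.
data AbsStep : ℕ → ℕ → Set where
  grow   : ∀ {u} → AbsStep u (2 + u)
  shrink : ∀ {u} → AbsStep (2 + u) u
  cross  : AbsStep 1 1

absStep-sym : ∀ {u v} → AbsStep u v → AbsStep v u
absStep-sym grow   = shrink
absStep-sym shrink = grow
absStep-sym cross  = cross

absStep : ∀ i → AbsStep ∣ i ∣ ∣ i ℤ.+ + 2 ∣
absStep (+ n) = subst (AbsStep n) (+-comm 2 n) grow
absStep -[1+ 0 ] = cross
absStep -[1+ 1 ] = shrink
absStep -[1+ suc (suc n) ] = shrink

Path-subst : ∀ {τ u u′ v e e′ X} → u ≡ u′ → e ≡ e′ → Path τ u v e X → Path τ u′ v e′ X
Path-subst refl refl p = p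

-- `AbsStep` leads from the inner window to the outer one, whereas a `Path` is read inwards; hence
-- `grow` gives `down` and `shrink` gives `up`.
extendPath : ∀ {τ u u′ v e X} → AbsStep u u′ → Path τ u v e X →
  ∃ λ v′ → Path (2 + τ) u′ v′ e (3 * (u′ * u′) + e * e + X)
extendPath grow   p = _ , down p
extendPath shrink p = _ , up p
extendPath {e = e} cross p = _ , stay p (m≤m+n e 2)

peelPath : ∀ {τ X v} U E U′ E′ →
  (U ≡ U′ ℤ.+ + 2 × E ≡ E′) ⊎ (U′ ≡ U ℤ.+ + 2 × E ≡ E′) ⊎ (U ≡ U′ × (E′ ≡ E ℤ.+ + 2 ⊎ E′ ≡ E ℤ.- + 2)) →
  Path τ (∣ U′ ∣) v (∣ E′ ∣) X →
  ∃ λ v′ → Path (2 + τ) (∣ U ∣) v′ (∣ E ∣) (3 * (∣ U ∣ * ∣ U ∣) + ∣ E ∣ * ∣ E ∣ + X)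
peelPath U E U′ E′ (inj₁ (refl , refl)) p = extendPath (absStep U′) p
peelPath U E U′ E′ (inj₂ (inj₁ (refl , refl))) p = extendPath (absStep-sym (absStep U)) p
peelPath U E U′ E′ (inj₂ (inj₂ (refl , inj₁ refl))) p = _ , stay p (ℤ.∣i+j∣≤∣i∣+∣j∣ E (+ 2))
peelPath U E U′ E′ (inj₂ (inj₂ (refl , inj₂ refl))) p = _ , stay p (ℤ.∣i-j∣≤∣i∣+∣j∣ E (+ 2))

-- One element is removed at each end of a window: equal signs there change U by 2 and fix E,
-- opposite signs change E by 2 and fix U.
endpoints : ∀ σ a a′ b b′ →
  a′ ≡ a ℤ.+ 1ℤ ⊎ a′ ≡ a ℤ.- 1ℤ → b ≡ b′ ℤ.+ 1ℤ ⊎ b ≡ b′ ℤ.- 1ℤ →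
  let U = b ℤ.- a ; E = + 2 ℤ.* σ ℤ.- a ℤ.- b ; U′ = b′ ℤ.- a′ ; E′ = + 2 ℤ.* σ ℤ.- a′ ℤ.- b′ in
  (U ≡ U′ ℤ.+ + 2 × E ≡ E′) ⊎ (U′ ≡ U ℤ.+ + 2 × E ≡ E′) ⊎ (U ≡ U′ × (E′ ≡ E ℤ.+ + 2 ⊎ E′ ≡ E ℤ.- + 2))
endpoints σ a a′ b b′ (inj₁ refl) (inj₁ refl) = inj₁ (lem₁ a b′ , lem₂ σ a b′)
  where
  lem₁ : ∀ a b → (b ℤ.+ 1ℤ) ℤ.- a ≡ b ℤ.- (a ℤ.+ 1ℤ) ℤ.+ + 2
  lem₁ = ℤ-Solver.solve-∀
  lem₂ : ∀ σ a b → + 2 ℤ.* σ ℤ.- a ℤ.- (b ℤ.+ 1ℤ) ≡ + 2 ℤ.* σ ℤ.- (a ℤ.+ 1ℤ) ℤ.- b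
  lem₂ = ℤ-Solver.solve-∀
endpoints σ a a′ b b′ (inj₂ refl) (inj₂ refl) = inj₂ (inj₁ (lem₁ a b′ , lem₂ σ a b′))
  where
  lem₁ : ∀ a b → b ℤ.- (a ℤ.- 1ℤ) ≡ (b ℤ.- 1ℤ) ℤ.- a ℤ.+ + 2
  lem₁ = ℤ-Solver.solve-∀
  lem₂ : ∀ σ a b → + 2 ℤ.* σ ℤ.- a ℤ.- (b ℤ.- 1ℤ) ≡ + 2 ℤ.* σ ℤ.- (a ℤ.- 1ℤ) ℤ.- b
  lem₂ = ℤ-Solver.solve-∀
endpoints σ a a′ b b′ (inj₁ refl) (inj₂ refl) = inj₂ (inj₂ (lem₁ a b′ , inj₂ (lem₂ σ a b′)))
  where
  lem₁ : ∀ a b → (b ℤ.- 1ℤ) ℤ.- a ≡ b ℤ.- (a ℤ.+ 1ℤ)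
  lem₁ = ℤ-Solver.solve-∀
  lem₂ : ∀ σ a b → + 2 ℤ.* σ ℤ.- (a ℤ.+ 1ℤ) ℤ.- b ≡ + 2 ℤ.* σ ℤ.- a ℤ.- (b ℤ.- 1ℤ) ℤ.- + 2
  lem₂ = ℤ-Solver.solve-∀
endpoints σ a a′ b b′ (inj₂ refl) (inj₁ refl) = inj₂ (inj₂ (lem₁ a b′ , inj₁ (lem₂ σ a b′)))
  where
  lem₁ : ∀ a b → (b ℤ.+ 1ℤ) ℤ.- a ≡ b ℤ.- (a ℤ.- 1ℤ)
  lem₁ = ℤ-Solver.solve-∀
  lem₂ : ∀ σ a b → + 2 ℤ.* σ ℤ.- (a ℤ.- 1ℤ) ℤ.- b ≡ + 2 ℤ.* σ ℤ.- a ℤ.- (b ℤ.+ 1ℤ) ℤ.+ + 2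
  lem₂ = ℤ-Solver.solve-∀

-- Each pair of positions p and τ - p occurs twice on the antidiagonal. For even τ the middle
-- position occurs once but is doubled in 2 X, whence an inequality.
peel : ∀ σ τ A → UnitSteps A → ∃₂ λ v X →
  Path τ (∣ A τ ℤ.- A 0 ∣) v (∣ + 2 ℤ.* σ ℤ.- A 0 ℤ.- A τ ∣) X ×
  diagᶻ τ (λ i j → weight σ (A i) (A j)) ℤ.≤ + (2 * X)
peel σ zero A steps = _ , _ , Path-subst (sym u≡0) refl even , (begin
  weight σ (A 0) (A 0)                                         ≡⟨ weight-abs σ (A 0) (A 0) ⟩
  + (3 * (∣ A 0 ℤ.- A 0 ∣ * ∣ A 0 ℤ.- A 0 ∣) + ∣ E ∣ * ∣ E ∣)  ≡⟨ cong (λ u → + (3 * (u * u) + ∣ E ∣ * ∣ E ∣)) u≡0 ⟩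
  + (∣ E ∣ * ∣ E ∣)                                            ≤⟨ ℤ.+≤+ (m≤m+n _ _) ⟩
  + (2 * (∣ E ∣ * ∣ E ∣))                                      ∎)
  where
  open ℤ.≤-Reasoning
  E = + 2 ℤ.* σ ℤ.- A 0 ℤ.- A 0
  u≡0 : ∣ A 0 ℤ.- A 0 ∣ ≡ 0
  u≡0 = cong ∣_∣ (ℤ.+-inverseʳ (A 0))
peel σ (suc zero) A steps = _ , _ , Path-subst (sym u≡1) refl odd , ℤ.≤-reflexive (begin
  weight σ (A 0) (A 1) ℤ.+ weight σ (A 1) (A 0)  ≡⟨ cong₂ ℤ._+_ w≡ (trans (weight-sym σ (A 0) (A 1)) w≡) ⟩
  + (3 + ∣ E ∣ * ∣ E ∣ + (3 + ∣ E ∣ * ∣ E ∣))    ≡⟨ cong +_ (lem (3 + ∣ E ∣ * ∣ E ∣)) ⟩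
  + (2 * (3 + ∣ E ∣ * ∣ E ∣))                    ∎)
  where
  open ≡-Reasoning
  E = + 2 ℤ.* σ ℤ.- A 0 ℤ.- A 1
  lem : ∀ x → x + x ≡ 2 * x
  lem = solve-∀
  abs-step : ∀ a b → b ≡ a ℤ.+ 1ℤ ⊎ b ≡ a ℤ.- 1ℤ → ∣ b ℤ.- a ∣ ≡ 1
  abs-step a _ (inj₁ refl) = cong ∣_∣ (plus a)
    where
    plus : ∀ a → (a ℤ.+ 1ℤ) ℤ.- a ≡ 1ℤ
    plus = ℤ-Solver.solve-∀
  abs-step a _ (inj₂ refl) = cong ∣_∣ (minus a)
    where
    minus : ∀ a → (a ℤ.- 1ℤ) ℤ.- a ≡ ℤ.- 1ℤ
    minus = ℤ-Solver.solve-∀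
  u≡1 : ∣ A 1 ℤ.- A 0 ∣ ≡ 1
  u≡1 = abs-step (A 0) (A 1) (steps 0)
  w≡ : weight σ (A 0) (A 1) ≡ + (3 + ∣ E ∣ * ∣ E ∣)
  w≡ = trans (weight-abs σ (A 0) (A 1)) (cong (λ u → + (3 * (u * u) + ∣ E ∣ * ∣ E ∣)) u≡1)
peel σ (suc (suc τ)) A steps with peel σ τ (λ i → A (suc i)) (λ i → steps (suc i))
... | v , X , p , d≤2X with peelPath _ _ _ _ (endpoints σ (A 0) (A 1) (A (2 + τ)) (A (1 + τ)) (steps 0) (steps (1 + τ))) p
...   | v′ , p′ = v′ , _ , p′ , (begin
  diagᶻ (2 + τ) f
    ≡⟨ cong (λ x → f 0 (2 + τ) ℤ.+ x) (diagᶻ-last τ (λ i j → f (suc i) j)) ⟩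
  f 0 (2 + τ) ℤ.+ (diagᶻ τ (λ i j → f (suc i) (suc j)) ℤ.+ f (2 + τ) 0)
    ≤⟨ ℤ.+-mono-≤ (ℤ.≤-reflexive w≡) (ℤ.+-mono-≤ d≤2X (ℤ.≤-reflexive (trans (weight-sym σ (A 0) (A (2 + τ))) w≡))) ⟩
  + (w + (2 * X + w))
    ≡⟨ cong +_ (lem w X) ⟩
  + (2 * (w + X)) ∎)
  where
  open ℤ.≤-Reasoning
  f = λ i j → weight σ (A i) (A j)
  u = ∣ A (2 + τ) ℤ.- A 0 ∣
  e = ∣ + 2 ℤ.* σ ℤ.- A 0 ℤ.- A (2 + τ) ∣
  w = 3 * (u * u) + e * e
  w≡ : f 0 (2 + τ) ≡ + w
  w≡ = weight-abs σ (A 0) (A (2 + τ))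
  lem : ∀ w X → w + (2 * X + w) ≡ 2 * (w + X)
  lem = solve-∀

-- Lower bound

∑-below : ∀ l n (g : ℕ → ℕ) → l ≤ n → ∑ l g ≤ ∑ n (λ j → ⟦ j <ᵇ l ⟧ * g j)
∑-below zero    n       g _         = z≤n
∑-below (suc l) (suc n) g (s≤s l≤n) =
  +-mono-≤ (≤-reflexive (sym (*-identityˡ (g 0)))) (∑-below l n (λ j → g (suc j)) l≤n)

-- The row i = 0 contributes the first term of every antidiagonal; removing it lowers l by one and
-- shifts the first argument of f.
∑-diag-below : ∀ l m n (f : ℕ → ℕ → ℕ) → l ≤ m → l ≤ n →
  ∑ l (λ t → diag t f) ≤ ∑ m (λ i → ∑ n (λ j → ⟦ i + j <ᵇ l ⟧ * f i j))
∑-diag-below zero    m       n f _         _    = z≤n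
∑-diag-below (suc l) (suc m) n f (s≤s l≤m) l<n = begin
  f 0 0 + ∑ l (λ t → f 0 (suc t) + diag t f′)               ≡⟨ cong (λ x → f 0 0 + x) (∑-+ l (λ t → f 0 (suc t)) (λ t → diag t f′)) ⟩
  f 0 0 + (∑ l (λ t → f 0 (suc t)) + ∑ l (λ t → diag t f′)) ≡⟨ +-assoc (f 0 0) _ _ ⟨
  ∑ (suc l) (f 0) + ∑ l (λ t → diag t f′)
    ≤⟨ +-mono-≤ (∑-below (suc l) n (f 0) l<n) (∑-diag-below l m n f′ l≤m (≤-trans (n≤1+n l) l<n)) ⟩
  ∑ (suc m) (λ i → ∑ n (λ j → ⟦ i + j <ᵇ suc l ⟧ * f i j))  ∎
  where
  open ≤-Reasoning
  f′ = λ i j → f (suc i) j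

T⇒≡true : ∀ {b} → T b → b ≡ true
T⇒≡true {true} _ = refl

≡true⇒T : ∀ {b} → b ≡ true → T b
≡true⇒T refl = tt

-- By symmetry each ordered pair can be put in increasing order; the pairs with i = j are counted
-- twice on the right.
∑-symmetric : ∀ n (f : ℕ → ℕ → ℕ) → (∀ i j → f i j ≡ f j i) →
  ∑ n (λ i → ∑ n (f i)) ≤ 2 * ∑ n (λ i → ∑ n (λ j → ⟦ i ≤ᵇ j ⟧ * f i j))
∑-symmetric n f f-sym = begin
  ∑ n (λ i → ∑ n (f i))
    ≤⟨ ∑-mono n (λ i _ → ∑-mono n (λ j _ → split i j)) ⟩
  ∑ n (λ i → ∑ n (λ j → ⟦ i ≤ᵇ j ⟧ * f i j + ⟦ j ≤ᵇ i ⟧ * f j i))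
    ≡⟨ ∑-cong n (λ i → ∑-+ n _ _) ⟩
  ∑ n (λ i → ∑ n (λ j → ⟦ i ≤ᵇ j ⟧ * f i j) + ∑ n (λ j → ⟦ j ≤ᵇ i ⟧ * f j i))
    ≡⟨ ∑-+ n _ _ ⟩
  half + ∑ n (λ i → ∑ n (λ j → ⟦ j ≤ᵇ i ⟧ * f j i))
    ≡⟨ cong (λ x → half + x) (∑-swap n n (λ i j → ⟦ j ≤ᵇ i ⟧ * f j i)) ⟩
  half + half
    ≡⟨ cong (λ x → half + x) (+-identityʳ half) ⟨
  2 * half ∎
  where
  open ≤-Reasoning
  half = ∑ n (λ i → ∑ n (λ j → ⟦ i ≤ᵇ j ⟧ * f i j))
  split : ∀ i j → f i j ≤ ⟦ i ≤ᵇ j ⟧ * f i j + ⟦ j ≤ᵇ i ⟧ * f j i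
  split i j with ≤-total i j
  ... | inj₁ i≤j rewrite T⇒≡true (≤⇒≤ᵇ i≤j) | *-identityˡ (f i j) = m≤m+n _ _
  ... | inj₂ j≤i rewrite T⇒≡true (≤⇒≤ᵇ j≤i) | *-identityˡ (f j i) | f-sym i j = m≤n+m _ _

∑³-rotate : ∀ n (f : ℕ → ℕ → ℕ → ℕ) →
  ∑ n (λ i → ∑ n (λ j → ∑ n (λ l → f i j l))) ≡ ∑ n (λ l → ∑ n (λ i → ∑ n (λ j → f i j l)))
∑³-rotate n f = trans (∑-cong n (λ i → ∑-swap n n (f i))) (∑-swap n n (λ i l → ∑ n (λ j → f i j l)))

-- The condition on the values amounts to i + j + k + 1 < l, and k + 1 ≤ 0.
value-below : ∀ κ i j l → i + j < l → value -[1+ suc κ ] i ℤ.+ value -[1+ suc κ ] j ℤ.< value -[1+ suc κ ] l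
value-below κ i j l i+j<l = begin-strict
  k ℤ.+ (1ℤ ℤ.+ + i) ℤ.+ (k ℤ.+ (1ℤ ℤ.+ + j))  ≡⟨ lem₁ k (+ i) (+ j) ⟩
  + (i + j) ℤ.+ (k ℤ.+ (k ℤ.+ + 2))            <⟨ ℤ.+-monoˡ-< (k ℤ.+ (k ℤ.+ + 2)) (ℤ.+<+ i+j<l) ⟩
  + l ℤ.+ (k ℤ.+ (k ℤ.+ + 2))                  ≤⟨ ℤ.+-monoʳ-≤ (+ l) (ℤ.+-monoʳ-≤ k k+2≤1) ⟩
  + l ℤ.+ (k ℤ.+ 1ℤ)                           ≡⟨ lem₂ k (+ l) ⟩
  k ℤ.+ (1ℤ ℤ.+ + l)                           ∎
  where
  open ℤ.≤-Reasoning
  k = -[1+ suc κ ]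
  k+2≤1 : k ℤ.+ + 2 ℤ.≤ 1ℤ
  k+2≤1 = ℤ.+-monoˡ-≤ (+ 2) {k} { -[1+ 0 ]} (ℤ.-≤- z≤n)
  lem₁ : ∀ k i j → k ℤ.+ (1ℤ ℤ.+ i) ℤ.+ (k ℤ.+ (1ℤ ℤ.+ j)) ≡ i ℤ.+ j ℤ.+ (k ℤ.+ (k ℤ.+ + 2))
  lem₁ = ℤ-Solver.solve-∀
  lem₂ : ∀ k l → l ℤ.+ (k ℤ.+ 1ℤ) ≡ k ℤ.+ (1ℤ ℤ.+ l)
  lem₂ = ℤ-Solver.solve-∀

mono-below : ∀ κ c i j l →
  ⟦ i ≤ᵇ j ⟧ * (⟦ i + j <ᵇ l ⟧ * ⟦ sameColour c i j l ⟧) ≤ ⟦ mono -[1+ suc κ ] c i j l ⟧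
mono-below κ c i j l with i ≤ᵇ j | i + j <ᵇ l in eq
... | false | _     = z≤n
... | true  | false = z≤n
... | true  | true
    rewrite T⇒≡true (≤⇒≤ᵇ (≤-trans (m≤n+m j i) (<⇒≤ (<ᵇ⇒< (i + j) l (≡true⇒T eq)))))
    with (value -[1+ suc κ ] i ℤ.+ value -[1+ suc κ ] j) ℤ.<? value -[1+ suc κ ] l
...   | yes _ = ≤-reflexive (trans (*-identityˡ _) (*-identityˡ _))
...   | no ¬p = contradiction (value-below κ i j l (<ᵇ⇒< (i + j) l (≡true⇒T eq))) ¬p

sameColour-sym : ∀ c i j l → sameColour c i j l ≡ sameColour c j i l
sameColour-sym c i j l with c i | c j | c l
... | true  | true  | _     = refl
... | false | false | _     = refl
... | true  | false | true  = refl
... | true  | false | false = refl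
... | false | true  | true  = refl
... | false | true  | false = refl

-- The pairs (i, j) are ordered and the shift by k is dropped, so that for fixed l the count is a
-- sum over the antidiagonals i + j = t < l.
orderedCount : (ℕ → Bool) → ℕ → ℕ
orderedCount c n = ∑ n (λ l → ∑ l (λ t → diag t (λ i j → ⟦ sameColour c i j l ⟧)))

orderedCount≤2*mono : ∀ κ c n →
  orderedCount c n ≤ 2 * ∑ n (λ i → ∑ n (λ j → ∑ n (λ l → ⟦ mono -[1+ suc κ ] c i j l ⟧)))
orderedCount≤2*mono κ c n = begin
  orderedCount c n
    ≤⟨ ∑-mono n (λ l l<n → ≤-trans (∑-diag-below l n n _ (<⇒≤ l<n) (<⇒≤ l<n)) (∑-symmetric n (F l) (F-sym l))) ⟩
  ∑ n (λ l → 2 * ∑ n (λ i → ∑ n (λ j → ⟦ i ≤ᵇ j ⟧ * F l i j)))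
    ≡⟨ ∑-*ˡ n 2 _ ⟩
  2 * ∑ n (λ l → ∑ n (λ i → ∑ n (λ j → ⟦ i ≤ᵇ j ⟧ * F l i j)))
    ≤⟨ *-monoʳ-≤ 2 (∑-mono n (λ l _ → ∑-mono n (λ i _ → ∑-mono n (λ j _ → mono-below κ c i j l)))) ⟩
  2 * ∑ n (λ l → ∑ n (λ i → ∑ n (λ j → ⟦ mono -[1+ suc κ ] c i j l ⟧)))
    ≡⟨ cong (λ x → 2 * x) (∑³-rotate n (λ i j l → ⟦ mono -[1+ suc κ ] c i j l ⟧)) ⟨
  2 * ∑ n (λ i → ∑ n (λ j → ∑ n (λ l → ⟦ mono -[1+ suc κ ] c i j l ⟧))) ∎
  where
  open ≤-Reasoning
  F : ℕ → ℕ → ℕ → ℕ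
  F l i j = ⟦ i + j <ᵇ l ⟧ * ⟦ sameColour c i j l ⟧
  F-sym : ∀ l i j → F l i j ≡ F l j i
  F-sym l i j rewrite +-comm i j | sameColour-sym c i j l = refl

-- Signs, and the path of a colouring

sign : Bool → ℤ
sign true  = 1ℤ
sign false = ℤ.- 1ℤ

orderedCount≡tripleForm : ∀ c n → + 4 ℤ.* + orderedCount c n ≡ tripleForm (λ i → sign (c i)) n
orderedCount≡tripleForm c n =
  ∑ᶻ-scaled n (+ 4) _ _ λ l → ∑ᶻ-scaled l (+ 4) _ _ λ t → diagᶻ-scaled t (+ 4) _ _ λ i j → pointwise i j l
  where
  pointwise : ∀ i j l → + 4 ℤ.* + ⟦ sameColour c i j l ⟧ ≡
    1ℤ ℤ.+ sign (c i) ℤ.* sign (c j) ℤ.+ sign (c l) ℤ.* (sign (c i) ℤ.+ sign (c j))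
  pointwise i j l with c i | c j | c l
  ... | true  | true  | true  = refl
  ... | true  | true  | false = refl
  ... | true  | false | true  = refl
  ... | true  | false | false = refl
  ... | false | true  | true  = refl
  ... | false | true  | false = refl
  ... | false | false | true  = refl
  ... | false | false | false = refl

-- The outermost window has a = S 0 = 0 and b = σ, hence U = E = σ and t = |σ|. The factor 6 clears
-- the denominator of `tetrahedral`, and terms are moved across so that no subtraction remains.
orderedCount-weight : ∀ c n → ∃₂ λ t v → ∃ λ X → Path n t v t X ×
  4 * (n * n * n) + 24 * (suc n * (t * t)) ≤ 96 * orderedCount c n + 12 * X + 4 * n
orderedCount-weight c n with peel (∑ᶻ s n) n (∑ᶻ s) steps
  where
  s = λ i → sign (c i)
  steps : UnitSteps (∑ᶻ s)
  steps i with c i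
  ... | true  = inj₁ refl
  ... | false = inj₂ refl
... | v , X , p , d≤2X = ∣ σ ∣ , v , X , Path-subst u≡ e≡ p , ℤ.drop‿+≤+ (begin
  + (4 * (n * n * n) + 24 * (suc n * (∣ σ ∣ * ∣ σ ∣)))
    ≡⟨ cast₁ ⟩
  + 4 ℤ.* (+ n ℤ.* + n ℤ.* + n) ℤ.+ + 24 ℤ.* (+ suc n ℤ.* (σ ℤ.* σ))
    ≡⟨ lem₁ (+ n) (+ suc n) (tetrahedral n) σ (sym (tetrahedral-closed n)) ⟩
  + 6 ℤ.* (+ 4 ℤ.* tetrahedral n ℤ.+ + suc n ℤ.* (+ 4 ℤ.* (σ ℤ.* σ)) ℤ.- d) ℤ.+ + 6 ℤ.* d ℤ.+ + 4 ℤ.* + n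
    ≡⟨ cong (λ x → + 6 ℤ.* x ℤ.+ + 6 ℤ.* d ℤ.+ + 4 ℤ.* + n) (sym (tripleForm-weight s n)) ⟩
  + 6 ℤ.* (+ 4 ℤ.* tripleForm s n) ℤ.+ + 6 ℤ.* d ℤ.+ + 4 ℤ.* + n
    ≡⟨ cong (λ x → + 6 ℤ.* (+ 4 ℤ.* x) ℤ.+ + 6 ℤ.* d ℤ.+ + 4 ℤ.* + n) (sym (orderedCount≡tripleForm c n)) ⟩
  + 6 ℤ.* (+ 4 ℤ.* (+ 4 ℤ.* + O)) ℤ.+ + 6 ℤ.* d ℤ.+ + 4 ℤ.* + n
    ≤⟨ ℤ.+-monoˡ-≤ (+ 4 ℤ.* + n) (ℤ.+-monoʳ-≤ (+ 6 ℤ.* (+ 4 ℤ.* (+ 4 ℤ.* + O))) (ℤ.*-monoˡ-≤-nonNeg (+ 6) d≤2X)) ⟩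
  + 6 ℤ.* (+ 4 ℤ.* (+ 4 ℤ.* + O)) ℤ.+ + 6 ℤ.* + (2 * X) ℤ.+ + 4 ℤ.* + n
    ≡⟨ cast₂ ⟩
  + (96 * O + 12 * X + 4 * n) ∎)
  where
  open ℤ.≤-Reasoning
  s = λ i → sign (c i)
  σ = ∑ᶻ s n
  O = orderedCount c n
  d = diagᶻ n (λ i j → weight σ (∑ᶻ s i) (∑ᶻ s j))
  u≡ : ∣ σ ℤ.- 0ℤ ∣ ≡ ∣ σ ∣
  u≡ = cong ∣_∣ (ℤ.+-identityʳ σ)
  e≡ : ∣ + 2 ℤ.* σ ℤ.- 0ℤ ℤ.- σ ∣ ≡ ∣ σ ∣
  e≡ = cong ∣_∣ (lem σ)
    where
    lem : ∀ σ → + 2 ℤ.* σ ℤ.- 0ℤ ℤ.- σ ≡ σ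
    lem = ℤ-Solver.solve-∀
  cast₁ : + (4 * (n * n * n) + 24 * (suc n * (∣ σ ∣ * ∣ σ ∣))) ≡
          + 4 ℤ.* (+ n ℤ.* + n ℤ.* + n) ℤ.+ + 24 ℤ.* (+ suc n ℤ.* (σ ℤ.* σ))
  cast₁ = cong₂ ℤ._+_
    (trans (ℤ.pos-* 4 (n * n * n)) (cong (λ x → + 4 ℤ.* x) (trans (ℤ.pos-* (n * n) n) (cong (λ x → x ℤ.* + n) (ℤ.pos-* n n)))))
    (trans (ℤ.pos-* 24 (suc n * (∣ σ ∣ * ∣ σ ∣))) (cong (λ x → + 24 ℤ.* x)
      (trans (ℤ.pos-* (suc n) (∣ σ ∣ * ∣ σ ∣)) (cong (λ x → + suc n ℤ.* x) (+∣i∣*∣i∣ σ)))))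
  cast₂ : + 6 ℤ.* (+ 4 ℤ.* (+ 4 ℤ.* + O)) ℤ.+ + 6 ℤ.* + (2 * X) ℤ.+ + 4 ℤ.* + n ≡ + (96 * O + 12 * X + 4 * n)
  cast₂ = sym (cong₂ ℤ._+_ (cong₂ ℤ._+_
      (trans (ℤ.pos-* 96 O) (lem₂ (+ O)))
      (trans (cong +_ (lem₃ X)) (ℤ.pos-* 6 (2 * X))))
    (ℤ.pos-* 4 n))
    where
    lem₂ : ∀ x → + 96 ℤ.* x ≡ + 6 ℤ.* (+ 4 ℤ.* (+ 4 ℤ.* x))
    lem₂ = ℤ-Solver.solve-∀
    lem₃ : ∀ x → 12 * x ≡ 6 * (2 * x)
    lem₃ = solve-∀
  lem₁ : ∀ n m T σ → n ℤ.* n ℤ.* n ℤ.- n ≡ + 6 ℤ.* T →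
    + 4 ℤ.* (n ℤ.* n ℤ.* n) ℤ.+ + 24 ℤ.* (m ℤ.* (σ ℤ.* σ)) ≡
    + 6 ℤ.* (+ 4 ℤ.* T ℤ.+ m ℤ.* (+ 4 ℤ.* (σ ℤ.* σ)) ℤ.- d) ℤ.+ + 6 ℤ.* d ℤ.+ + 4 ℤ.* n
  lem₁ n m T σ h = trans (lem₄ n m σ) (trans (cong (λ x → + 4 ℤ.* x ℤ.+ + 24 ℤ.* (m ℤ.* (σ ℤ.* σ)) ℤ.+ + 4 ℤ.* n) h) (lem₅ n m T σ d))
    where
    lem₄ : ∀ n m σ → + 4 ℤ.* (n ℤ.* n ℤ.* n) ℤ.+ + 24 ℤ.* (m ℤ.* (σ ℤ.* σ)) ≡
      + 4 ℤ.* (n ℤ.* n ℤ.* n ℤ.- n) ℤ.+ + 24 ℤ.* (m ℤ.* (σ ℤ.* σ)) ℤ.+ + 4 ℤ.* n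
    lem₄ = ℤ-Solver.solve-∀
    lem₅ : ∀ n m T σ d → + 4 ℤ.* (+ 6 ℤ.* T) ℤ.+ + 24 ℤ.* (m ℤ.* (σ ℤ.* σ)) ℤ.+ + 4 ℤ.* n ≡
      + 6 ℤ.* (+ 4 ℤ.* T ℤ.+ m ℤ.* (+ 4 ℤ.* (σ ℤ.* σ)) ℤ.- d) ℤ.+ + 6 ℤ.* d ℤ.+ + 4 ℤ.* n
    lem₅ = ℤ-Solver.solve-∀

-- Paying for the growth of |U|, and inequalities between cubes

2ab≤a²+b² : ∀ a b → 2 * (a * b) ≤ a * a + b * b
2ab≤a²+b² a b with ≤-total a b
... | inj₁ a≤b with m≤n⇒∃[o]m+o≡n a≤b
...   | d , refl = ≤-trans (m≤m+n _ (d * d)) (≤-reflexive (lem a d))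
  where
  lem : ∀ a d → 2 * (a * (a + d)) + d * d ≡ a * a + (a + d) * (a + d)
  lem = solve-∀
2ab≤a²+b² a b | inj₂ b≤a with m≤n⇒∃[o]m+o≡n b≤a
...   | d , refl = ≤-trans (m≤m+n _ (d * d)) (≤-reflexive (lem b d))
  where
  lem : ∀ b d → 2 * ((b + d) * b) + d * d ≡ (b + d) * (b + d) + b * b
  lem = solve-∀

-- The difference of the two sides is (u - 3v)².
8uv≤8v²+[u+v]² : ∀ u v → 8 * (u * v) ≤ 8 * (v * v) + (u + v) * (u + v)
8uv≤8v²+[u+v]² u v = begin
  8 * (u * v)                                  ≡⟨ lem₁ u v ⟩
  2 * (u * (3 * v)) + 2 * (u * v)              ≤⟨ +-monoˡ-≤ (2 * (u * v)) (2ab≤a²+b² u (3 * v)) ⟩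
  u * u + 3 * v * (3 * v) + 2 * (u * v)        ≡⟨ lem₂ u v ⟩
  8 * (v * v) + (u + v) * (u + v)              ∎
  where
  open ≤-Reasoning
  lem₁ : ∀ u v → 8 * (u * v) ≡ 2 * (u * (3 * v)) + 2 * (u * v)
  lem₁ = solve-∀
  lem₂ : ∀ u v → u * u + 3 * v * (3 * v) + 2 * (u * v) ≡ 8 * (v * v) + (u + v) * (u + v)
  lem₂ = solve-∀

-- Since u + v ≤ 8 e, the term (u + v)² is covered by 8 e (u + v), and nothing has to be paid.
excess-zero : ∀ {Y ε} → Y ≤ 8 * ε → Excess 0 Y ε
excess-zero {Y} {ε} Y≤8ε .Excess.excess u v e ε≤e uv≤Y = begin
  48 * (u * v)                                   ≡⟨ *-assoc 6 8 (u * v) ⟩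
  6 * (8 * (u * v))                              ≤⟨ *-monoʳ-≤ 6 (8uv≤8v²+[u+v]² u v) ⟩
  6 * (8 * (v * v) + (u + v) * (u + v))          ≤⟨ *-monoʳ-≤ 6 (+-monoʳ-≤ (8 * (v * v)) (*-monoʳ-≤ (u + v) uv≤8e)) ⟩
  6 * (8 * (v * v) + (u + v) * (8 * e))          ≡⟨ lem u v e ⟩
  48 * (v * v + e * v + u * e) + 2 * 0           ∎
  where
  open ≤-Reasoning
  uv≤8e : u + v ≤ 8 * e
  uv≤8e = ≤-trans uv≤Y (≤-trans Y≤8ε (*-monoʳ-≤ 8 ε≤e))
  lem : ∀ u v e → 6 * (8 * (v * v) + (u + v) * (8 * e)) ≡ 48 * (v * v + e * v + u * e) + 2 * 0
  lem = solve-∀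

-- Without a lower bound on e, the term (u + v)² is at most Y² and is paid in full: 2 K = 6 Y².
excess-square : ∀ {Y ε} → Excess (3 * (Y * Y)) Y ε
excess-square {Y} {ε} .Excess.excess u v e ε≤e uv≤Y = begin
  48 * (u * v)                                   ≡⟨ *-assoc 6 8 (u * v) ⟩
  6 * (8 * (u * v))                              ≤⟨ *-monoʳ-≤ 6 (8uv≤8v²+[u+v]² u v) ⟩
  6 * (8 * (v * v) + (u + v) * (u + v))          ≤⟨ *-monoʳ-≤ 6 (+-monoʳ-≤ (8 * (v * v)) (*-mono-≤ uv≤Y uv≤Y)) ⟩
  6 * (8 * (v * v) + Y * Y)                      ≤⟨ m≤m+n _ (48 * (e * v + u * e)) ⟩
  6 * (8 * (v * v) + Y * Y) + 48 * (e * v + u * e) ≡⟨ lem u v e Y ⟩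
  48 * (v * v + e * v + u * e) + 2 * (3 * (Y * Y)) ∎
  where
  open ≤-Reasoning
  lem : ∀ u v e Y → 6 * (8 * (v * v) + Y * Y) + 48 * (e * v + u * e) ≡ 48 * (v * v + e * v + u * e) + 2 * (3 * (Y * Y))
  lem = solve-∀

0≤+* : ∀ m {i} → 0ℤ ℤ.≤ i → 0ℤ ℤ.≤ + m ℤ.* i
0≤+* m {i} 0≤i = ℤ.≤-trans (ℤ.≤-reflexive (sym (ℤ.*-zeroʳ (+ m)))) (ℤ.*-monoˡ-≤-nonNeg (+ m) 0≤i)

0≤i² : ∀ i → 0ℤ ℤ.≤ i ℤ.* i
0≤i² i = ℤ.≤-trans (ℤ.+≤+ z≤n) (ℤ.≤-reflexive (+∣i∣*∣i∣ i))

-- Hölder's inequality (t + 2v)³ ≤ (1 + 2√2)² (v³ + t³) with p / q ≥ √2 in place of √2.  The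
-- certificate `cert` comes from expanding v³ + t³ around the tangency point z = p t − q v = 0.
cubes-mean : ∀ p q t v .{{_ : NonZero p}} → 2 * (q * q) ≤ p * p →
  let n = t + 2 * v ; D = q + 2 * p in
  q * q * (n * n * n) ≤ D * D * (v * v * v + t * t * t)
cubes-mean p@(suc _) q t v 2q²≤p² with m≤n⇒∃[o]m+o≡n 2q²≤p²
... | θ , 2q²+θ≡p² = *-cancelˡ-≤ (8 * p * D) {{nz}} (ℤ.drop‿+≤+ (begin
  + (8 * p * D * (q * q * (n * n * n)))
    ≡⟨ cast₁ ⟩
  + 8 ℤ.* P ℤ.* D′ ℤ.* (Q ℤ.* Q ℤ.* (N ℤ.* N ℤ.* N))
    ≤⟨ ℤ.0≤i-j⇒j≤i (ℤ.≤-trans nonneg (ℤ.≤-reflexive (sym identity))) ⟩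
  + 8 ℤ.* P ℤ.* D′ ℤ.* (D′ ℤ.* D′ ℤ.* (V ℤ.* V ℤ.* V ℤ.+ U ℤ.* U ℤ.* U))
    ≡⟨ sym cast₂ ⟩
  + (8 * p * D * (D * D * (v * v * v + t * t * t))) ∎))
  where
  open ℤ.≤-Reasoning
  n = t + 2 * v
  D = q + 2 * p
  nz : NonZero (8 * p * D)
  nz = m*n≢0 (8 * p) D {{_}} {{≢-nonZero (λ e → 0≢1+n (sym (m+n≡0⇒n≡0 q e)))}}
  P = + p
  Q = + q
  U = + t
  V = + v
  Θ = + θ
  N = U ℤ.+ + 2 ℤ.* V
  D′ = Q ℤ.+ + 2 ℤ.* P
  z = P ℤ.* U ℤ.- Q ℤ.* V
  w = Θ ℤ.* N ℤ.- + 2 ℤ.* P ℤ.* z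
  N≡ : + n ≡ N
  N≡ = cong (λ x → U ℤ.+ x) (ℤ.pos-* 2 v)
  D≡ : + D ≡ D′
  D≡ = cong (λ x → Q ℤ.+ x) (ℤ.pos-* 2 p)
  cube : ∀ x → + (x * x * x) ≡ + x ℤ.* + x ℤ.* + x
  cube x = trans (ℤ.pos-* (x * x) x) (cong (λ y → y ℤ.* + x) (ℤ.pos-* x x))
  8pD : + (8 * p * D) ≡ + 8 ℤ.* P ℤ.* D′
  8pD = trans (ℤ.pos-* (8 * p) D) (cong₂ ℤ._*_ (ℤ.pos-* 8 p) D≡)
  cast₁ : + (8 * p * D * (q * q * (n * n * n))) ≡ + 8 ℤ.* P ℤ.* D′ ℤ.* (Q ℤ.* Q ℤ.* (N ℤ.* N ℤ.* N))
  cast₁ = trans (ℤ.pos-* (8 * p * D) _) (cong₂ ℤ._*_ 8pD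
    (trans (ℤ.pos-* (q * q) _) (cong₂ ℤ._*_ (ℤ.pos-* q q) (trans (cube n) (cong (λ x → x ℤ.* x ℤ.* x) N≡)))))
  cast₂ : + (8 * p * D * (D * D * (v * v * v + t * t * t))) ≡
          + 8 ℤ.* P ℤ.* D′ ℤ.* (D′ ℤ.* D′ ℤ.* (V ℤ.* V ℤ.* V ℤ.+ U ℤ.* U ℤ.* U))
  cast₂ = trans (ℤ.pos-* (8 * p * D) _) (cong₂ ℤ._*_ 8pD
    (trans (ℤ.pos-* (D * D) _) (cong₂ ℤ._*_ (trans (ℤ.pos-* D D) (cong (λ x → x ℤ.* x) D≡)) (cong₂ ℤ._+_ (cube v) (cube t)))))
  Θ≡ : Θ ≡ P ℤ.* P ℤ.- + 2 ℤ.* (Q ℤ.* Q)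
  Θ≡ = begin-equality
    Θ                                                                  ≡⟨ lem (+ 2 ℤ.* (Q ℤ.* Q)) Θ ⟩
    + 2 ℤ.* (Q ℤ.* Q) ℤ.+ Θ ℤ.- + 2 ℤ.* (Q ℤ.* Q)                      ≡⟨ cong (λ x → x ℤ.- + 2 ℤ.* (Q ℤ.* Q)) eq ⟩
    P ℤ.* P ℤ.- + 2 ℤ.* (Q ℤ.* Q)                                      ∎
    where
    lem : ∀ a b → b ≡ a ℤ.+ b ℤ.- a
    lem = ℤ-Solver.solve-∀
    eq : + 2 ℤ.* (Q ℤ.* Q) ℤ.+ Θ ≡ P ℤ.* P
    eq = trans (cong (λ x → x ℤ.+ Θ) (sym (trans (ℤ.pos-* 2 (q * q)) (cong (λ x → + 2 ℤ.* x) (ℤ.pos-* q q)))))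
               (trans (cong +_ 2q²+θ≡p²) (ℤ.pos-* p p))
  -- At `Θ` and `w` each summand is a product of nonnegative factors, `Θ` being the defect p² - 2q²;
  -- all three vanish when Θ = z = 0.
  cert : ℤ → ℤ → ℤ
  cert θ w =
    + 2 ℤ.* (N ℤ.* (+ 3 ℤ.* (w ℤ.* w))) ℤ.+
    + 2 ℤ.* (N ℤ.* (θ ℤ.* (N ℤ.* N ℤ.* (P ℤ.* P ℤ.+ + 6 ℤ.* (Q ℤ.* Q))))) ℤ.+
    + 4 ℤ.* (P ℤ.* ((+ 7 ℤ.* U ℤ.* D′ ℤ.+ + 17 ℤ.* Q ℤ.* N) ℤ.* (z ℤ.* z)))
  identity : + 8 ℤ.* P ℤ.* D′ ℤ.* (D′ ℤ.* D′ ℤ.* (V ℤ.* V ℤ.* V ℤ.+ U ℤ.* U ℤ.* U)) ℤ.-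
             + 8 ℤ.* P ℤ.* D′ ℤ.* (Q ℤ.* Q ℤ.* (N ℤ.* N ℤ.* N)) ≡ cert Θ w
  identity = trans (lem P Q U V) (cong (λ θ → cert θ (θ ℤ.* N ℤ.- + 2 ℤ.* P ℤ.* z)) (sym Θ≡))
    where
    lem : ∀ P Q U V → let N = U ℤ.+ + 2 ℤ.* V ; D = Q ℤ.+ + 2 ℤ.* P ; z = P ℤ.* U ℤ.- Q ℤ.* V
                          θ = P ℤ.* P ℤ.- + 2 ℤ.* (Q ℤ.* Q) ; w = θ ℤ.* N ℤ.- + 2 ℤ.* P ℤ.* z in
      + 8 ℤ.* P ℤ.* D ℤ.* (D ℤ.* D ℤ.* (V ℤ.* V ℤ.* V ℤ.+ U ℤ.* U ℤ.* U)) ℤ.-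
      + 8 ℤ.* P ℤ.* D ℤ.* (Q ℤ.* Q ℤ.* (N ℤ.* N ℤ.* N)) ≡
           + 2 ℤ.* (N ℤ.* (+ 3 ℤ.* (w ℤ.* w))) ℤ.+
           + 2 ℤ.* (N ℤ.* (θ ℤ.* (N ℤ.* N ℤ.* (P ℤ.* P ℤ.+ + 6 ℤ.* (Q ℤ.* Q))))) ℤ.+
           + 4 ℤ.* (P ℤ.* ((+ 7 ℤ.* U ℤ.* D ℤ.+ + 17 ℤ.* Q ℤ.* N) ℤ.* (z ℤ.* z)))
    lem = ℤ-Solver.solve-∀
  nonneg : 0ℤ ℤ.≤ cert Θ w
  nonneg = ℤ.+-mono-≤ (ℤ.+-mono-≤
      (0≤+* 2 (subst (λ x → 0ℤ ℤ.≤ x ℤ.* (+ 3 ℤ.* (w ℤ.* w))) N≡ (0≤+* n (0≤+* 3 (0≤i² w)))))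
      (0≤+* 2 (subst (λ x → 0ℤ ℤ.≤ x ℤ.* (Θ ℤ.* (N ℤ.* N ℤ.* (P ℤ.* P ℤ.+ + 6 ℤ.* (Q ℤ.* Q))))) N≡
        (0≤+* n (0≤+* θ (subst (λ x → 0ℤ ℤ.≤ x ℤ.* (P ℤ.* P ℤ.+ + 6 ℤ.* (Q ℤ.* Q))) (trans (ℤ.pos-* n n) (cong (λ x → x ℤ.* x) N≡))
          (0≤+* (n * n) (ℤ.+-mono-≤ (0≤i² P) (0≤+* 6 (0≤i² Q))))))))))
    (0≤+* 4 (0≤+* p (subst (λ x → 0ℤ ℤ.≤ x ℤ.* (z ℤ.* z)) coeff (0≤+* (7 * t * D + 17 * q * n) (0≤i² z)))))
    where
    coeff : + (7 * t * D + 17 * q * n) ≡ + 7 ℤ.* U ℤ.* D′ ℤ.+ + 17 ℤ.* Q ℤ.* N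
    coeff = cong₂ ℤ._+_ (trans (ℤ.pos-* (7 * t) D) (cong₂ ℤ._*_ (ℤ.pos-* 7 t) D≡))
                        (trans (ℤ.pos-* (17 * q) n) (cong₂ ℤ._*_ (ℤ.pos-* 17 q) N≡))

-- For v ≥ 7t the mean inequality is far from tight: replacing q² by D² / 13 still leaves room for
-- the payment K v with K = 3 Y². Writing v = 7t + x turns the claim into nonnegativity of the
-- coefficients.
cubes-mean-slack : ∀ p q t v → 2 * (q * q) ≤ p * p → 7 * t ≤ v →
  let n = t + 2 * v ; D = q + 2 * p ; Y = t + v in
  16 * (q * q * (n * n * n)) + D * D * (3 * (Y * Y) * v) ≤ D * D * (16 * (v * v * v + t * t * t))
cubes-mean-slack p q t v 2q²≤p² 7t≤v with m≤n⇒∃[o]m+o≡n 7t≤v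
... | x , refl = *-cancelˡ-≤ 13 (begin
  13 * (16 * (q * q * C) + D * D * (3 * (Y * Y) * v))
    ≡⟨ lem₁ (q * q) C (D * D) (3 * (Y * Y) * v) ⟩
  16 * (13 * (q * q) * C) + D * D * (13 * (3 * (Y * Y) * v))
    ≤⟨ +-monoˡ-≤ _ (*-monoʳ-≤ 16 (*-monoˡ-≤ C 13q²≤D²)) ⟩
  16 * (D * D * C) + D * D * (13 * (3 * (Y * Y) * v))
    ≡⟨ lem₂ C (D * D) (13 * (3 * (Y * Y) * v)) ⟩
  D * D * (16 * C + 13 * (3 * (Y * Y) * v))
    ≤⟨ *-monoʳ-≤ (D * D) (≤-trans (m≤m+n _ (41 * (x * x * x) + 591 * (x * x * t) + 2112 * (x * t * t) + 80 * (t * t * t))) (≤-reflexive (lem₃ t x))) ⟩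
  D * D * (13 * (16 * (v * v * v + t * t * t)))
    ≡⟨ lem₄ (D * D) (16 * (v * v * v + t * t * t)) ⟩
  13 * (D * D * (16 * (v * v * v + t * t * t))) ∎)
  where
  open ≤-Reasoning
  n = t + 2 * v
  D = q + 2 * p
  Y = t + v
  C = n * n * n
  q≤p : q ≤ p
  q≤p with q ≤? p
  ... | yes h = h
  ... | no ¬h = contradiction (<-≤-trans (*-mono-< (≰⇒> ¬h) (≰⇒> ¬h)) (≤-trans (m≤m+n (q * q) _) 2q²≤p²)) (<-irrefl refl)
  -- This is (1 + 2√2)² > 13, read off from q ≤ p and 2q² ≤ p².
  13q²≤D² : 13 * (q * q) ≤ D * D
  13q²≤D² = begin
    13 * (q * q)                                       ≡⟨ lem₅ q ⟩
    q * q + 4 * (q * q) + 4 * (2 * (q * q))            ≤⟨ +-mono-≤ (+-monoʳ-≤ (q * q) (*-monoʳ-≤ 4 (*-monoʳ-≤ q q≤p))) (*-monoʳ-≤ 4 2q²≤p²) ⟩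
    q * q + 4 * (q * p) + 4 * (p * p)                  ≡⟨ lem₆ q p ⟩
    D * D                                              ∎
    where
    lem₅ : ∀ q → 13 * (q * q) ≡ q * q + 4 * (q * q) + 4 * (2 * (q * q))
    lem₅ = solve-∀
    lem₆ : ∀ q p → q * q + 4 * (q * p) + 4 * (p * p) ≡ (q + 2 * p) * (q + 2 * p)
    lem₆ = solve-∀
  lem₁ : ∀ a b c d → 13 * (16 * (a * b) + c * d) ≡ 16 * (13 * a * b) + c * (13 * d)
  lem₁ = solve-∀
  lem₂ : ∀ a b c → 16 * (b * a) + b * c ≡ b * (16 * a + c)
  lem₂ = solve-∀
  lem₃ : ∀ t x → let v = 7 * t + x ; n = t + 2 * v in
    16 * (n * n * n) + 13 * (3 * ((t + v) * (t + v)) * v) + (41 * (x * x * x) + 591 * (x * x * t) + 2112 * (x * t * t) + 80 * (t * t * t))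
    ≡ 13 * (16 * (v * v * v + t * t * t))
  lem₃ = solve-∀
  lem₄ : ∀ a b → a * (13 * b) ≡ 13 * (a * b)
  lem₄ = solve-∀

-- For u = e = t and n = t + 2v, twice `potential` plus 16 (v³ + t³) is exactly 4 n³ + 24 n t². So
-- the bound on X with Y = t + v and L = n leaves the two cubes, and n ≥ 1 lets n² absorb the
-- smaller errors.
Path-cubes : ∀ {n t v X O K} → Path n t v t X → 1 ≤ n → Excess K (t + v) t →
  4 * (n * n * n) + 24 * (suc n * (t * t)) ≤ 96 * O + 12 * X + 4 * n →
  16 * (v * v * v + t * t * t) ≤ 96 * O + K * v + 88 * (n * n)
Path-cubes {n} {t} {v} {X} {O} {K} p 1≤n H h = +-cancelˡ-≤ (2 * potential t v t) _ _ (begin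
  2 * potential t v t + 16 * (v * v * v + t * t * t)
    ≤⟨ m≤m+n _ (24 * (t * t)) ⟩
  2 * potential t v t + 16 * (v * v * v + t * t * t) + 24 * (t * t)
    ≡⟨ cubes ⟩
  4 * (n * n * n) + 24 * (suc n * (t * t))
    ≤⟨ h ⟩
  96 * O + 12 * X + 4 * n
    ≤⟨ +-monoˡ-≤ (4 * n) (+-monoʳ-≤ (96 * O) (Path-bound H p t ≤-refl ≤-refl ≤-refl (≤-reflexive t+2v≡n))) ⟩
  96 * O + (2 * potential t v t + K * v + error (t + v) n n) + 4 * n
    ≤⟨ +-mono-≤ (+-monoʳ-≤ (96 * O) (+-monoʳ-≤ (2 * potential t v t + K * v) error≤)) (*-monoʳ-≤ 4 n≤n²) ⟩
  96 * O + (2 * potential t v t + K * v + 84 * (n * n)) + 4 * (n * n)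
    ≡⟨ lem₂ (96 * O) (2 * potential t v t) (K * v) (n * n) ⟩
  2 * potential t v t + (96 * O + K * v + 88 * (n * n)) ∎)
  where
  open ≤-Reasoning
  t+2v≡n : t + 2 * v ≡ n
  t+2v≡n = Path-length p
  t+v≤n : t + v ≤ n
  t+v≤n = ≤-trans (+-monoʳ-≤ t (m≤m+n v _)) (≤-reflexive t+2v≡n)
  lem₁ : ∀ t v → let n = t + 2 * v in
    2 * (18 * (t * t * v) + 3 * (t * t * t) + 8 * (v * v * v)
      + 6 * (v * t * (2 * v + t)) + 3 * ((t + 2 * v) * (t + 2 * v) * t))
    + 16 * (v * v * v + t * t * t) + 24 * (t * t) ≡ 4 * (n * n * n) + 24 * ((1 + n) * (t * t))
  lem₁ = solve-∀
  cubes : 2 * potential t v t + 16 * (v * v * v + t * t * t) + 24 * (t * t) ≡ 4 * (n * n * n) + 24 * (suc n * (t * t))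
  cubes = trans (lem₁ t v) (cong (λ n → 4 * (n * n * n) + 24 * (suc n * (t * t))) t+2v≡n)
  n≤n² : n ≤ n * n
  n≤n² = ≤-trans (≤-reflexive (sym (*-identityʳ n))) (*-monoʳ-≤ n 1≤n)
  36≤36n² : 36 ≤ 36 * (n * n)
  36≤36n² = *-monoʳ-≤ 36 {1} {n * n} (≤-trans 1≤n n≤n²)
  error≤ : error (t + v) n n ≤ 84 * (n * n)
  error≤ = begin
    36 * ((t + v) * n) + (36 + 12 * (n * n))
      ≤⟨ +-mono-≤ (*-monoʳ-≤ 36 (*-monoˡ-≤ n t+v≤n)) (+-monoˡ-≤ (12 * (n * n)) 36≤36n²) ⟩
    36 * (n * n) + (36 * (n * n) + 12 * (n * n))
      ≡⟨ lem₃ (n * n) ⟩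
    84 * (n * n) ∎
    where
    lem₃ : ∀ m → 36 * m + (36 * m + 12 * m) ≡ 84 * m
    lem₃ = solve-∀
  lem₂ : ∀ a b c m → a + (b + c + 84 * m) + 4 * m ≡ b + (a + c + 88 * m)
  lem₂ = solve-∀


-- K stays quantified, because the choice of `Excess` depends on how v compares with 7t.
orderedCount-cubes : ∀ c n → 1 ≤ n → ∃₂ λ t v → t + 2 * v ≡ n ×
  (∀ {K} → Excess K (t + v) t → 16 * (v * v * v + t * t * t) ≤ 96 * orderedCount c n + K * v + 88 * (n * n))
orderedCount-cubes c n 1≤n =
  let t , v , X , p , h = orderedCount-weight c n
  in t , v , Path-length p , λ H → Path-cubes {O = orderedCount c n} p 1≤n H h

cubes-lower : ∀ {n t v O} p q .{{_ : NonZero p}} → 2 * (q * q) ≤ p * p → t + 2 * v ≡ n →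
  (∀ {K} → Excess K (t + v) t → 16 * (v * v * v + t * t * t) ≤ 96 * O + K * v + 88 * (n * n)) →
  v ≤ 7 * t ⊎ 7 * t ≤ v →
  let D = q + 2 * p in 16 * (q * q * (n * n * n)) ≤ D * D * (96 * O + 88 * (n * n))
-- Here t + v ≤ 8t, so K = 0 is allowed.
cubes-lower {n} {t} {v} {O} p q 2q²≤p² refl h (inj₁ v≤7t) = begin
  16 * (q * q * (n * n * n))                ≤⟨ *-monoʳ-≤ 16 (cubes-mean p q t v 2q²≤p²) ⟩
  16 * (D * D * (v * v * v + t * t * t))    ≡⟨ lem₁ (D * D) (v * v * v + t * t * t) ⟩
  D * D * (16 * (v * v * v + t * t * t))    ≤⟨ *-monoʳ-≤ (D * D) (h (excess-zero (+-monoʳ-≤ t v≤7t))) ⟩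
  D * D * (96 * O + 0 + 88 * (n * n))       ≡⟨ cong (λ x → D * D * (x + 88 * (n * n))) (+-identityʳ (96 * O)) ⟩
  D * D * (96 * O + 88 * (n * n))           ∎
  where
  open ≤-Reasoning
  D = q + 2 * p
  lem₁ : ∀ a b → 16 * (a * b) ≡ a * (16 * b)
  lem₁ = solve-∀
-- For small |σ|, K = 3 (t + v)² is taken and K v is cancelled against the slack.
cubes-lower {n} {t} {v} {O} p q 2q²≤p² refl h (inj₂ 7t≤v) = +-cancelʳ-≤ (D * D * (3 * (Y * Y) * v)) _ _ (begin
  16 * (q * q * (n * n * n)) + D * D * (3 * (Y * Y) * v)      ≤⟨ cubes-mean-slack p q t v 2q²≤p² 7t≤v ⟩
  D * D * (16 * (v * v * v + t * t * t))                      ≤⟨ *-monoʳ-≤ (D * D) (h excess-square) ⟩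
  D * D * (96 * O + 3 * (Y * Y) * v + 88 * (n * n))           ≡⟨ lem₁ (D * D) (96 * O) (3 * (Y * Y) * v) (88 * (n * n)) ⟩
  D * D * (96 * O + 88 * (n * n)) + D * D * (3 * (Y * Y) * v) ∎)
  where
  open ≤-Reasoning
  D = q + 2 * p
  Y = t + v
  lem₁ : ∀ a b c d → a * (b + c + d) ≡ a * (b + d) + a * c
  lem₁ = solve-∀

orderedCount-lower : ∀ c n p q .{{_ : NonZero p}} → 1 ≤ n → 2 * (q * q) ≤ p * p → let D = q + 2 * p in
  16 * (q * q * (n * n * n)) ≤ D * D * (96 * orderedCount c n + 88 * (n * n))
orderedCount-lower c n p q 1≤n 2q²≤p² =
  let t , v , eq , h = orderedCount-cubes c n 1≤n
  in cubes-lower {O = orderedCount c n} p q 2q²≤p² eq h (≤-total v (7 * t))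

M-lower-bound : ∀ κ n p q .{{_ : NonZero p}} → 1 ≤ n → 2 * (q * q) ≤ p * p → let D = q + 2 * p in
  2 * (q * q * (n * n * n)) ≤ D * D * (24 * M -[1+ suc κ ] n + 11 * (n * n))
M-lower-bound κ n p q 1≤n 2q²≤p² =
  let Δ , Δ≤M = M-attained k n in
  *-cancelˡ-≤ 8 (begin
  8 * (2 * (q * q * (n * n * n)))
    ≡⟨ *-assoc 8 2 (q * q * (n * n * n)) ⟨
  16 * (q * q * (n * n * n))
    ≤⟨ orderedCount-lower (extend Δ) n p q 1≤n 2q²≤p² ⟩
  D * D * (96 * orderedCount (extend Δ) n + 88 * (n * n))
    ≤⟨ *-monoʳ-≤ (D * D) (+-monoˡ-≤ (88 * (n * n)) (*-monoʳ-≤ 96 (≤-trans (orderedCount≤2*mono κ (extend Δ) n)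
         (*-monoʳ-≤ 2 (≤-trans (≤-reflexive (sym (monoCount≡∑ k n Δ (extend Δ) (extend-toℕ Δ)))) Δ≤M))))) ⟩
  D * D * (96 * (2 * M k n) + 88 * (n * n))
    ≡⟨ lem (D * D) (M k n) (n * n) ⟩
  8 * (D * D * (24 * M k n + 11 * (n * n))) ∎)
  where
  open ≤-Reasoning
  k = -[1+ suc κ ]
  D = q + 2 * p
  lem : ∀ a b c → a * (96 * (2 * b) + 88 * c) ≡ 8 * (a * (24 * b + 11 * c))
  lem = solve-∀

-- Upper bound

∑-interval : ∀ n a b → ∑ n (λ j → ⟦ a <ᵇ suc j ⟧ * ⟦ j <ᵇ b ⟧) ≤ b ∸ a
∑-interval zero    a       b       = z≤n
∑-interval (suc n) a       zero    = ≤-trans (≤-reflexive (trans (∑-cong (suc n) (λ j → *-zeroʳ ⟦ a <ᵇ suc j ⟧)) (∑-zero (suc n)))) z≤n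
∑-interval (suc n) zero    (suc b) = s≤s (∑-interval n zero b)
∑-interval (suc n) (suc a) (suc b) = ∑-interval n a b

-- The terms t - 2i with i ≥ m form an arithmetic progression of step 2 with sum about (t - 2m)² /
-- 4; the `+ 2` absorbs rounding, and truncated subtraction cuts off the terms with 2i > t.
∑-halving : ∀ n m t → 4 * ∑ n (λ i → ⟦ m <ᵇ suc i ⟧ * (t ∸ (i + i))) ≤ (t ∸ (m + m) + 2) * (t ∸ (m + m) + 2)
∑-halving zero m t = z≤n
∑-halving (suc n) m t = subst (λ x → 4 * (⟦ m <ᵇ 1 ⟧ * t + x) ≤ (t ∸ (m + m) + 2) * (t ∸ (m + m) + 2))
  (∑-cong n (λ i → cong (⟦ m <ᵇ suc (suc i) ⟧ *_) (sym (shift t i)))) (go m)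
  where
  open ≤-Reasoning
  shift : ∀ t i → t ∸ (suc i + suc i) ≡ t ∸ 2 ∸ (i + i)
  shift t i = trans (cong (t ∸_) (cong suc (+-suc i i))) (sym (∸-+-assoc t 2 (i + i)))
  base : ∀ t → 4 * t + (t ∸ 2 + 2) * (t ∸ 2 + 2) ≤ (t + 2) * (t + 2)
  base 0 = ≤-refl
  base 1 = n≤1+n 8
  base (suc (suc x)) = ≤-trans (m≤m+n _ 4) (≤-reflexive (lem x))
    where
    lem : ∀ x → 4 * (2 + x) + (x + 2) * (x + 2) + 4 ≡ (2 + x + 2) * (2 + x + 2)
    lem = solve-∀
  go : ∀ m → 4 * (⟦ m <ᵇ 1 ⟧ * t + ∑ n (λ i → ⟦ m <ᵇ suc (suc i) ⟧ * (t ∸ 2 ∸ (i + i)))) ≤ (t ∸ (m + m) + 2) * (t ∸ (m + m) + 2)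
  go zero = begin
    4 * (1 * t + rest)                   ≡⟨ *-distribˡ-+ 4 (1 * t) rest ⟩
    4 * (1 * t) + 4 * rest               ≤⟨ +-mono-≤ (≤-reflexive (cong (4 *_) (*-identityˡ t))) (∑-halving n 0 (t ∸ 2)) ⟩
    4 * t + (t ∸ 2 + 2) * (t ∸ 2 + 2)    ≤⟨ base t ⟩
    (t + 2) * (t + 2)                    ∎
    where rest = ∑ n (λ i → 1 * (t ∸ 2 ∸ (i + i)))
  go (suc m) = subst (λ x → 4 * ∑ n (λ i → ⟦ m <ᵇ suc i ⟧ * (t ∸ 2 ∸ (i + i))) ≤ (x + 2) * (x + 2))
    (sym (shift t m)) (∑-halving n m (t ∸ 2))

-- Telescoping of 3 x² ≤ (x + 1)³ - x³; the offset c is arbitrary because the induction raises it by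
-- 1.
∑-squares-below : ∀ n m c → ∑ n (λ l → ⟦ l <ᵇ m ⟧ * (3 * ((l + c) * (l + c)))) + c * c * c ≤ (m + c) * (m + c) * (m + c)
∑-squares-below zero    m       c = *-mono-≤ (*-mono-≤ (m≤n+m c m) (m≤n+m c m)) (m≤n+m c m)
∑-squares-below (suc n) zero    c rewrite ∑-zero n = ≤-refl
∑-squares-below (suc n) (suc m) c = begin
  1 * (3 * (c * c)) + ∑ n (λ l → ⟦ l <ᵇ m ⟧ * (3 * ((suc l + c) * (suc l + c)))) + c * c * c
    ≡⟨ cong (λ x → 1 * (3 * (c * c)) + x + c * c * c) (∑-cong n (λ l → cong (λ x → ⟦ l <ᵇ m ⟧ * (3 * (x * x))) (sym (+-suc l c)))) ⟩
  1 * (3 * (c * c)) + rest + c * c * c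
    ≤⟨ m≤m+n _ (3 * c + 1) ⟩
  1 * (3 * (c * c)) + rest + c * c * c + (3 * c + 1)
    ≡⟨ lem c rest ⟩
  rest + suc c * suc c * suc c
    ≤⟨ ∑-squares-below n m (suc c) ⟩
  (m + suc c) * (m + suc c) * (m + suc c)
    ≡⟨ cong (λ x → x * x * x) (+-suc m c) ⟩
  (suc m + c) * (suc m + c) * (suc m + c) ∎
  where
  open ≤-Reasoning
  rest = ∑ n (λ l → ⟦ l <ᵇ m ⟧ * (3 * ((l + suc c) * (l + suc c))))
  lem : ∀ c r → 1 * (3 * (c * c)) + r + c * c * c + (3 * c + 1) ≡ r + (1 + c) * (1 + c) * (1 + c)
  lem = solve-∀

-- The same telescoping, except that y is constantly 2 while l + c ≤ a; such a term costs 3 · 2² =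
-- 12, hence the 12 n.
∑-squares-above : ∀ n c a → let y = λ l → l + c ∸ a + 2 in
  ∑ n (λ l → 3 * (y l * y l)) ≤ y n * y n * y n + 12 * n
∑-squares-above zero    c a = z≤n
∑-squares-above (suc n) c a = begin
  ∑ (suc n) (λ l → 3 * (y l * y l))                ≡⟨ ∑-last n (λ l → 3 * (y l * y l)) ⟩
  ∑ n (λ l → 3 * (y l * y l)) + 3 * (y n * y n)    ≤⟨ +-monoˡ-≤ _ (∑-squares-above n c a) ⟩
  y n * y n * y n + 12 * n + 3 * (y n * y n)       ≤⟨ step (≤-total a (n + c)) ⟩
  y (suc n) * y (suc n) * y (suc n) + 12 * suc n   ∎
  where
  open ≤-Reasoning
  y = λ l → l + c ∸ a + 2
  step : a ≤ n + c ⊎ n + c ≤ a →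
    y n * y n * y n + 12 * n + 3 * (y n * y n) ≤ y (suc n) * y (suc n) * y (suc n) + 12 * suc n
  step (inj₁ a≤n+c) rewrite +-∸-assoc 1 a≤n+c =
    ≤-trans (m≤m+n _ (3 * y n + 13)) (≤-reflexive (lem (y n) n))
    where
    lem : ∀ x n → x * x * x + 12 * n + 3 * (x * x) + (3 * x + 13) ≡ (1 + x) * (1 + x) * (1 + x) + 12 * (1 + n)
    lem = solve-∀
  step (inj₂ n+c≤a) rewrite m≤n⇒m∸n≡0 n+c≤a = begin
    8 + 12 * n + 12                                  ≡⟨ lem n ⟩
    8 + 12 * suc n                                   ≤⟨ +-monoˡ-≤ (12 * suc n) (*-mono-≤ (*-mono-≤ 2≤y 2≤y) 2≤y) ⟩
    y (suc n) * y (suc n) * y (suc n) + 12 * suc n   ∎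
    where
    2≤y : 2 ≤ y (suc n)
    2≤y = m≤n+m 2 _
    lem : ∀ n → 8 + 12 * n + 12 ≡ 8 + 12 * (1 + n)
    lem = solve-∀

-- Counting for a threshold colouring

value-above : ∀ κ i j l → value -[1+ suc κ ] i ℤ.+ value -[1+ suc κ ] j ℤ.< value -[1+ suc κ ] l → i + j < l + suc κ
value-above κ i j l h = ℤ.drop‿+<+ (begin-strict
  + i ℤ.+ + j                                                   ≡⟨ lem₁ k (+ i) (+ j) ⟩
  k ℤ.+ (1ℤ ℤ.+ + i) ℤ.+ (k ℤ.+ (1ℤ ℤ.+ + j)) ℤ.+ (ℤ.- k ℤ.- k ℤ.- + 2)  <⟨ ℤ.+-monoˡ-< (ℤ.- k ℤ.- k ℤ.- + 2) h ⟩
  k ℤ.+ (1ℤ ℤ.+ + l) ℤ.+ (ℤ.- k ℤ.- k ℤ.- + 2)                  ≡⟨ lem₂ k (+ l) ⟩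
  -- Here -k - 1 is `suc κ`, so the shift widens the range by a constant only.
  + l ℤ.+ (ℤ.- k ℤ.- 1ℤ)                                        ∎)
  where
  open ℤ.≤-Reasoning
  k = -[1+ suc κ ]
  lem₁ : ∀ k i j → i ℤ.+ j ≡ k ℤ.+ (1ℤ ℤ.+ i) ℤ.+ (k ℤ.+ (1ℤ ℤ.+ j)) ℤ.+ (ℤ.- k ℤ.- k ℤ.- + 2)
  lem₁ = ℤ-Solver.solve-∀
  lem₂ : ∀ k l → k ℤ.+ (1ℤ ℤ.+ l) ℤ.+ (ℤ.- k ℤ.- k ℤ.- + 2) ≡ l ℤ.+ (ℤ.- k ℤ.- 1ℤ)
  lem₂ = ℤ-Solver.solve-∀

-- The extremal colouring; the count below splits according to whether l < m or m ≤ i.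
threshold : ℕ → ℕ → Bool
threshold m i = m <ᵇ suc i

<⇒<ᵇ≡true : ∀ {m n} → m < n → (m <ᵇ n) ≡ true
<⇒<ᵇ≡true m<n = T⇒≡true (<⇒<ᵇ m<n)

<ᵇ≡false⇒≥ : ∀ {m n} → (m <ᵇ n) ≡ false → n ≤ m
<ᵇ≡false⇒≥ {m} {n} e = ≮⇒≥ λ m<n → contradiction (trans (sym e) (<⇒<ᵇ≡true m<n)) λ ()

-- With i ≤ j ≤ l, a triple is monochromatic only if l < m or m ≤ i. `S` is the indicator of i ≤ j <
-- l + κ + 1 - i.
mono-above : ∀ κ m i j l →
  let S = ⟦ i <ᵇ suc j ⟧ * ⟦ j <ᵇ l + suc κ ∸ i ⟧ in
  ⟦ mono -[1+ suc κ ] (threshold m) i j l ⟧ ≤ ⟦ l <ᵇ m ⟧ * S + ⟦ m <ᵇ suc i ⟧ * S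
mono-above κ m i j l with i ≤ᵇ j in i≤ᵇj | j ≤ᵇ l
... | false | _     = z≤n
... | true  | false = z≤n
... | true  | true  with (value -[1+ suc κ ] i ℤ.+ value -[1+ suc κ ] j) ℤ.<? value -[1+ suc κ ] l
...   | no _  = z≤n
...   | yes h
      rewrite <⇒<ᵇ≡true (s≤s (≤ᵇ⇒≤ i j (≡true⇒T i≤ᵇj)))
            | <⇒<ᵇ≡true (m+n≤o⇒m≤o∸n (suc j) (subst (_< l + suc κ) (+-comm i j) (value-above κ i j l h)))
      with m <ᵇ suc i | m <ᵇ suc j | m <ᵇ suc l in m≤l
...     | true  | true  | true  = m≤n+m 1 _
...     | true  | true  | false = z≤n
...     | true  | false | _     = z≤n
...     | false | true  | _     = z≤n
...     | false | false | true  = z≤n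
...     | false | false | false rewrite <⇒<ᵇ≡true (<ᵇ≡false⇒≥ {m} {suc l} m≤l) = ≤-refl

-- For fixed l, summing over j and then i gives about l² / 4 for triples below m and (l - 2m)² / 4
-- for those from m on; summing over l gives m³ / 12 and (n - 2m)³ / 12.
threshold-count : ∀ κ m n →
  let y = n + suc κ ∸ (m + m) + 2 in
  12 * ∑ n (λ i → ∑ n (λ j → ∑ n (λ l → ⟦ mono -[1+ suc κ ] (threshold m) i j l ⟧)))
  ≤ (m + (suc κ + 2)) * (m + (suc κ + 2)) * (m + (suc κ + 2)) + (y * y * y + 12 * n)
threshold-count κ m n = begin
  12 * ∑ n (λ i → ∑ n (λ j → ∑ n (λ l → ⟦ mono -[1+ suc κ ] (threshold m) i j l ⟧)))
    ≡⟨ cong (12 *_) (∑³-rotate n (λ i j l → ⟦ mono -[1+ suc κ ] (threshold m) i j l ⟧)) ⟩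
  12 * ∑ n (λ l → ∑ n (λ i → ∑ n (λ j → ⟦ mono -[1+ suc κ ] (threshold m) i j l ⟧)))
    ≡⟨ ∑-*ˡ n 12 _ ⟨
  ∑ n (λ l → 12 * ∑ n (λ i → ∑ n (λ j → ⟦ mono -[1+ suc κ ] (threshold m) i j l ⟧)))
    ≤⟨ ∑-mono n (λ l _ → perMax l) ⟩
  ∑ n (λ l → ⟦ l <ᵇ m ⟧ * (3 * (x l * x l)) + 3 * (y l * y l))
    ≡⟨ ∑-+ n _ _ ⟩
  ∑ n (λ l → ⟦ l <ᵇ m ⟧ * (3 * (x l * x l))) + ∑ n (λ l → 3 * (y l * y l))
    ≤⟨ +-mono-≤ (≤-trans (m≤m+n _ _) (∑-squares-below n m (suc κ + 2))) (∑-squares-above n (suc κ) (m + m)) ⟩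
  x m * x m * x m + (y n * y n * y n + 12 * n) ∎
  where
  open ≤-Reasoning
  x = λ l → l + (suc κ + 2)
  y = λ l → l + suc κ ∸ (m + m) + 2
  S : ℕ → ℕ → ℕ → ℕ
  S l i j = ⟦ i <ᵇ suc j ⟧ * ⟦ j <ᵇ l + suc κ ∸ i ⟧
  G : ℕ → ℕ → ℕ
  G l i = l + suc κ ∸ (i + i)
  perMin : ∀ l i → ∑ n (λ j → ⟦ mono -[1+ suc κ ] (threshold m) i j l ⟧) ≤ ⟦ l <ᵇ m ⟧ * G l i + ⟦ m <ᵇ suc i ⟧ * G l i
  perMin l i = begin
    ∑ n (λ j → ⟦ mono -[1+ suc κ ] (threshold m) i j l ⟧)
      ≤⟨ ∑-mono n (λ j _ → mono-above κ m i j l) ⟩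
    ∑ n (λ j → ⟦ l <ᵇ m ⟧ * S l i j + ⟦ m <ᵇ suc i ⟧ * S l i j)
      ≡⟨ ∑-+ n _ _ ⟩
    ∑ n (λ j → ⟦ l <ᵇ m ⟧ * S l i j) + ∑ n (λ j → ⟦ m <ᵇ suc i ⟧ * S l i j)
      ≡⟨ cong₂ _+_ (∑-*ˡ n ⟦ l <ᵇ m ⟧ (S l i)) (∑-*ˡ n ⟦ m <ᵇ suc i ⟧ (S l i)) ⟩
    ⟦ l <ᵇ m ⟧ * ∑ n (S l i) + ⟦ m <ᵇ suc i ⟧ * ∑ n (S l i)
      ≤⟨ +-mono-≤ (*-monoʳ-≤ ⟦ l <ᵇ m ⟧ S≤G) (*-monoʳ-≤ ⟦ m <ᵇ suc i ⟧ S≤G) ⟩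
    ⟦ l <ᵇ m ⟧ * G l i + ⟦ m <ᵇ suc i ⟧ * G l i ∎
    where
    S≤G : ∑ n (S l i) ≤ G l i
    S≤G = ≤-trans (∑-interval n i (l + suc κ ∸ i)) (≤-reflexive (∸-+-assoc (l + suc κ) i i))
  perMax : ∀ l → 12 * ∑ n (λ i → ∑ n (λ j → ⟦ mono -[1+ suc κ ] (threshold m) i j l ⟧))
                 ≤ ⟦ l <ᵇ m ⟧ * (3 * (x l * x l)) + 3 * (y l * y l)
  perMax l = begin
    12 * ∑ n (λ i → ∑ n (λ j → ⟦ mono -[1+ suc κ ] (threshold m) i j l ⟧))
      ≤⟨ *-monoʳ-≤ 12 (∑-mono n (λ i _ → perMin l i)) ⟩
    12 * ∑ n (λ i → ⟦ l <ᵇ m ⟧ * G l i + ⟦ m <ᵇ suc i ⟧ * G l i)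
      ≡⟨ cong (12 *_) (trans (∑-+ n _ _) (cong (λ s → s + B) (∑-*ˡ n ⟦ l <ᵇ m ⟧ (G l)))) ⟩
    12 * (⟦ l <ᵇ m ⟧ * ∑ n (G l) + B)
      ≡⟨ lem ⟦ l <ᵇ m ⟧ (∑ n (G l)) B ⟩
    ⟦ l <ᵇ m ⟧ * (3 * (4 * ∑ n (G l))) + 3 * (4 * B)
      ≤⟨ +-mono-≤ (*-monoʳ-≤ ⟦ l <ᵇ m ⟧ (*-monoʳ-≤ 3 G≤)) (*-monoʳ-≤ 3 (∑-halving n m (l + suc κ))) ⟩
    ⟦ l <ᵇ m ⟧ * (3 * (x l * x l)) + 3 * (y l * y l) ∎
    where
    B = ∑ n (λ i → ⟦ m <ᵇ suc i ⟧ * G l i)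
    G≤ : 4 * ∑ n (G l) ≤ x l * x l
    G≤ = begin
      4 * ∑ n (G l)                            ≡⟨ cong (4 *_) (∑-cong n (λ i → sym (*-identityˡ (G l i)))) ⟩
      4 * ∑ n (λ i → 1 * G l i)                ≤⟨ ∑-halving n 0 (l + suc κ) ⟩
      (l + suc κ + 2) * (l + suc κ + 2)        ≡⟨ cong (λ z → z * z) (+-assoc l (suc κ) 2) ⟩
      x l * x l                                ∎
    lem : ∀ a b c → 12 * (a * b + c) ≡ a * (3 * (4 * b)) + 3 * (4 * c)
    lem = solve-∀

-- The choice of the threshold

cube-shift : ∀ n p b → 1 ≤ n →
  (n * p + b) * (n * p + b) * (n * p + b) ≤ n * n * n * (p * p * p) + n * n * (3 * (p * p * b) + 3 * (p * b * b) + b * b * b)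
cube-shift (suc n) p b _ = ≤-trans (m≤m+n _ (n * suc n * (3 * (p * b * b)) + (n * n + 2 * n) * (b * b * b))) (≤-reflexive (lem n p b))
  where
  lem : ∀ n p b → let N = 1 + n in
    (N * p + b) * (N * p + b) * (N * p + b) + (n * N * (3 * (p * b * b)) + (n * n + 2 * n) * (b * b * b))
    ≡ N * N * N * (p * p * p) + N * N * (3 * (p * p * b) + 3 * (p * b * b) + b * b * b)
  lem = solve-∀

M-upper-bound : ∀ κ p q .{{_ : NonZero q}} → p * p ≤ 2 * (q * q) → let D = q + 2 * p in
  ∃ λ C → ∀ n → 1 ≤ n → 12 * (D * D * D) * M -[1+ suc κ ] n ≤ D * (q * q) * (n * n * n) + C * (n * n)
M-upper-bound κ p q@(suc _) p²≤2q² = C , bound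
  where
  open ≤-Reasoning
  D = q + 2 * p
  -- Large enough for D x and D y alike: `suc κ` is the shift, one 2 is the rounding in x and y, the
  -- other comes from the remainder of the division, doubled.
  b = D * (suc κ + 4)
  E = λ p → 3 * (p * p * b) + 3 * (p * b * b) + b * b * b
  C = E p + E q + 12 * (D * D * D)
  bound : ∀ n → 1 ≤ n → 12 * (D * D * D) * M -[1+ suc κ ] n ≤ D * (q * q) * (n * n * n) + C * (n * n)
  bound n 1≤n = begin
    12 * (D * D * D) * M k n
      ≡⟨ lem₁ (D * D * D) (M k n) ⟩
    D * D * D * (12 * M k n)
      ≤⟨ *-monoʳ-≤ (D * D * D) (≤-trans (*-monoʳ-≤ 12 (M-upper k n (threshold m))) (threshold-count κ m n)) ⟩
    D * D * D * (x * x * x + (y * y * y + 12 * n))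
      ≡⟨ lem₂ D x y n ⟩
    D * x * (D * x) * (D * x) + D * y * (D * y) * (D * y) + 12 * (D * D * D) * n
      ≤⟨ +-mono-≤ (+-mono-≤ (≤-trans (cube-mono Dx≤) (cube-shift n p b 1≤n)) (≤-trans (cube-mono Dy≤) (cube-shift n q b 1≤n)))
                  (*-monoʳ-≤ (12 * (D * D * D)) (≤-trans (≤-reflexive (sym (*-identityʳ n))) (*-monoʳ-≤ n 1≤n))) ⟩
    n * n * n * (p * p * p) + n * n * E p + (n * n * n * (q * q * q) + n * n * E q) + 12 * (D * D * D) * (n * n)
      ≡⟨ lem₃ (n * n * n) (n * n) (p * p * p) (q * q * q) (E p) (E q) (12 * (D * D * D)) ⟩
    (p * p * p + q * q * q) * (n * n * n) + C * (n * n)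
      ≤⟨ +-monoˡ-≤ (C * (n * n)) (*-monoˡ-≤ (n * n * n) p³+q³≤) ⟩
    D * (q * q) * (n * n * n) + C * (n * n) ∎
    where
    k = -[1+ suc κ ]
    -- With p / q near √2 this is the cut v = √2 |σ| of n = |σ| + 2v, so D m is about n p and D (n -
    -- 2m) about n q.
    m = n * p / D
    x = m + (suc κ + 2)
    y = n + suc κ ∸ (m + m) + 2
    cube-mono : ∀ {a c} → a ≤ c → a * a * a ≤ c * c * c
    cube-mono h = *-mono-≤ (*-mono-≤ h h) h
    np≤ : n * p ≤ D + m * D
    np≤ = ≤-trans (≤-reflexive (m≡m%n+[m/n]*n (n * p) D)) (+-monoˡ-≤ (m * D) (<⇒≤ (m%n<n (n * p) D)))
    Dx≤ : D * x ≤ n * p + b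
    Dx≤ = begin
      D * (m + (suc κ + 2))            ≡⟨ *-distribˡ-+ D m (suc κ + 2) ⟩
      D * m + D * (suc κ + 2)          ≤⟨ +-mono-≤ (≤-trans (≤-reflexive (*-comm D m)) (m/n*n≤m (n * p) D)) (*-monoʳ-≤ D (+-monoʳ-≤ (suc κ) (s≤s (s≤s z≤n)))) ⟩
      n * p + b                        ∎
    Dy≤ : D * y ≤ n * q + b
    Dy≤ = begin
      D * (n + suc κ ∸ (m + m) + 2)                  ≡⟨ *-distribˡ-+ D (n + suc κ ∸ (m + m)) 2 ⟩
      D * (n + suc κ ∸ (m + m)) + D * 2              ≡⟨ cong (λ z → z + D * 2) (*-distribˡ-∸ D (n + suc κ) (m + m)) ⟩
      D * (n + suc κ) ∸ D * (m + m) + D * 2          ≤⟨ +-monoˡ-≤ (D * 2) (m≤n+o⇒m∸n≤o (D * (n + suc κ)) (D * (m + m)) diff) ⟩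
      n * q + D * (suc κ + 2) + D * 2                ≡⟨ lem₅ (n * q) D (suc κ) ⟩
      n * q + b                                      ∎
      where
      diff : D * (n + suc κ) ≤ D * (m + m) + (n * q + D * (suc κ + 2))
      diff = begin
        D * (n + suc κ)                                   ≡⟨ lem₆ n p q (suc κ) ⟩
        n * q + 2 * (n * p) + D * suc κ                   ≤⟨ +-monoˡ-≤ (D * suc κ) (+-monoʳ-≤ (n * q) (*-monoʳ-≤ 2 np≤)) ⟩
        n * q + 2 * (D + m * D) + D * suc κ               ≡⟨ lem₇ (n * q) D m (suc κ) ⟩
        D * (m + m) + (n * q + D * (suc κ + 2))           ∎
        where
        lem₆ : ∀ n p q κ → (q + 2 * p) * (n + κ) ≡ n * q + 2 * (n * p) + (q + 2 * p) * κ
        lem₆ = solve-∀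
        lem₇ : ∀ a D m κ → a + 2 * (D + m * D) + D * κ ≡ D * (m + m) + (a + D * (κ + 2))
        lem₇ = solve-∀
      lem₅ : ∀ a D κ → a + D * (κ + 2) + D * 2 ≡ a + D * (κ + 4)
      lem₅ = solve-∀
    -- One factor D splits off here, which leaves q² / (12 D²) as the leading coefficient of the
    -- bound on `M`.
    p³+q³≤ : p * p * p + q * q * q ≤ D * (q * q)
    p³+q³≤ = begin
      p * p * p + q * q * q                ≤⟨ +-monoˡ-≤ (q * q * q) (*-monoˡ-≤ p p²≤2q²) ⟩
      2 * (q * q) * p + q * q * q          ≡⟨ lem₄ p q ⟩
      D * (q * q)                          ∎
      where
      lem₄ : ∀ p q → 2 * (q * q) * p + q * q * q ≡ (q + 2 * p) * (q * q)
      lem₄ = solve-∀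
    lem₁ : ∀ a b → 12 * a * b ≡ a * (12 * b)
    lem₁ = solve-∀
    lem₂ : ∀ D x y n → D * D * D * (x * x * x + (y * y * y + 12 * n)) ≡ D * x * (D * x) * (D * x) + D * y * (D * y) * (D * y) + 12 * (D * D * D) * n
    lem₂ = solve-∀
    lem₃ : ∀ n³ n² P Q e f g → n³ * P + n² * e + (n³ * Q + n² * f) + g * n² ≡ (P + Q) * n³ + (e + f + g) * n²
    lem₃ = solve-∀

-- Rational constants

-- Unnormalised fractions compare by cross-multiplication without greatest common divisors, so
-- rational inequalities become integer ones.
⌜_⌝ : ℕ → ℚᵘ
⌜ n ⌝ = mkℚᵘ (+ n) 0

toℚᵘ-ℕ : ∀ n → ℚ.toℚᵘ (ℕtoℚ n) ≃ ⌜ n ⌝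
toℚᵘ-ℕ n = ℚ.toℚᵘ-fromℚᵘ ⌜ n ⌝

toℚᵘ-cube : ∀ a n → ℚ.toℚᵘ (a ℚ.* (ℕtoℚ n ℚ.* ℕtoℚ n ℚ.* ℕtoℚ n)) ≃ ℚ.toℚᵘ a ℚᵘ.* ⌜ n * n * n ⌝
toℚᵘ-cube a n = ℚᵘ.≃-trans (ℚ.toℚᵘ-homo-* a _) (ℚᵘ.*-congˡ {ℚ.toℚᵘ a}
  (ℚᵘ.≃-trans (ℚ.toℚᵘ-homo-* (ℕtoℚ n ℚ.* ℕtoℚ n) (ℕtoℚ n))
    (ℚᵘ.≃-trans (ℚᵘ.*-cong (ℚᵘ.≃-trans (ℚ.toℚᵘ-homo-* (ℕtoℚ n) (ℕtoℚ n)) (ℚᵘ.*-cong (toℚᵘ-ℕ n) (toℚᵘ-ℕ n))) (toℚᵘ-ℕ n))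
      (*≡* (cong (λ x → x ℤ.* + 1) (sym (trans (ℤ.pos-* (n * n) n) (cong (λ x → x ℤ.* + n) (ℤ.pos-* n n)))))))))

toℚᵘ-den : ∀ p q-1 .(c : Coprime p (suc q-1)) → let r = mkℚ (+ p) q-1 c ; W = mkℚᵘ (+ (suc q-1 + 2 * p)) q-1 in
  ℚ.toℚᵘ (den r) ≃ ⌜ 12 ⌝ ℚᵘ.* (W ℚᵘ.* W)
toℚᵘ-den p q-1 c =
  ℚᵘ.≃-trans (ℚ.toℚᵘ-homo-* (ℕtoℚ 12) (s ℚ.* s))
    (ℚᵘ.*-congˡ {⌜ 12 ⌝} (ℚᵘ.≃-trans (ℚ.toℚᵘ-homo-* s s) (ℚᵘ.*-cong s≃W s≃W)))
  where
  q = suc q-1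
  r = mkℚ (+ p) q-1 c
  s = ℚ.1ℚ ℚ.+ ℕtoℚ 2 ℚ.* r
  -- For r = p / q this is 1 + 2r with the denominator q kept.
  W = mkℚᵘ (+ (q + 2 * p)) q-1
  s≃W : ℚ.toℚᵘ s ≃ W
  s≃W = ℚᵘ.≃-trans (ℚ.toℚᵘ-homo-+ ℚ.1ℚ (ℕtoℚ 2 ℚ.* r))
    (ℚᵘ.≃-trans (ℚᵘ.+-congʳ (⌜ 1 ⌝) (ℚ.toℚᵘ-homo-* (ℕtoℚ 2) r)) (*≡* eq))
    where
    eq : (+ 1 ℤ.* + (1 * q) ℤ.+ + 2 ℤ.* + p ℤ.* + 1) ℤ.* + q ≡ + (q + 2 * p) ℤ.* + (1 * (1 * q))
    eq = trans (cong₂ (λ x y → (+ 1 ℤ.* x ℤ.+ y ℤ.* + 1) ℤ.* + q) (cong +_ (*-identityˡ q)) (sym (ℤ.pos-* 2 p)))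
      (trans (lem (+ q) (+ (2 * p))) (cong (λ x → + (q + 2 * p) ℤ.* + x) (sym (trans (*-identityˡ (1 * q)) (*-identityˡ q)))))
      where
      lem : ∀ q x → (+ 1 ℤ.* q ℤ.+ x ℤ.* + 1) ℤ.* q ≡ (q ℤ.+ x) ℤ.* q
      lem = ℤ-Solver.solve-∀

toℚᵘ-*den : ∀ a p q-1 .(c : Coprime p (suc q-1)) → let r = mkℚ (+ p) q-1 c ; D = suc q-1 + 2 * p ; W = mkℚᵘ (+ D) q-1 in
  ℚ.toℚᵘ (a ℚ.* den r) ≃ ℚ.toℚᵘ a ℚᵘ.* (⌜ 12 ⌝ ℚᵘ.* (W ℚᵘ.* W))
toℚᵘ-*den a p q-1 c = ℚᵘ.≃-trans (ℚ.toℚᵘ-homo-* a _) (ℚᵘ.*-congˡ {ℚ.toℚᵘ a} (toℚᵘ-den p q-1 c))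

pos-12*D² : ∀ D → + 12 ℤ.* (+ D ℤ.* + D) ≡ + (12 * (D * D))
pos-12*D² D = sym (trans (ℤ.pos-* 12 (D * D)) (cong (λ x → + 12 ℤ.* x) (ℤ.pos-* D D)))

den-below : ∀ α a-1 .(c : Coprime ∣ α ∣ (suc a-1)) p q-1 .(c′ : Coprime p (suc q-1)) → mkℚ α a-1 c ℚ.* den (mkℚ (+ p) q-1 c′) ℚ.< ℚ.1ℚ →
  let D = suc q-1 + 2 * p in α ℤ.* + (12 * (D * D)) ℤ.< + (suc a-1 * (suc q-1 * suc q-1))
den-below α a-1 c p q-1 c′ h with ℚᵘ.<-respˡ-≃ (toℚᵘ-*den (mkℚ α a-1 c) p q-1 c′) (ℚ.toℚᵘ-mono-< h)
... | *<* h′ = subst₂ ℤ._<_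
  (trans (ℤ.*-identityʳ _) (cong (λ x → α ℤ.* x) (pos-12*D² (suc q-1 + 2 * p))))
  (trans (ℤ.*-identityˡ _) (cong (λ x → + (suc a-1 * x)) (*-identityˡ (suc q-1 * suc q-1)))) h′

den-above : ∀ α a-1 .(c : Coprime ∣ α ∣ (suc a-1)) p q-1 .(c′ : Coprime p (suc q-1)) → ℚ.1ℚ ℚ.< mkℚ α a-1 c ℚ.* den (mkℚ (+ p) q-1 c′) →
  let D = suc q-1 + 2 * p in + (suc a-1 * (suc q-1 * suc q-1)) ℤ.< α ℤ.* + (12 * (D * D))
den-above α a-1 c p q-1 c′ h with ℚᵘ.<-respʳ-≃ (toℚᵘ-*den (mkℚ α a-1 c) p q-1 c′) (ℚ.toℚᵘ-mono-< h)
... | *<* h′ = subst₂ ℤ._<_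
  (trans (ℤ.*-identityˡ _) (cong (λ x → + (suc a-1 * x)) (*-identityˡ (suc q-1 * suc q-1))))
  (trans (ℤ.*-identityʳ _) (cong (λ x → α ℤ.* x) (pos-12*D² (suc q-1 + 2 * p)))) h′

2<r² : ∀ p q-1 .(c : Coprime p (suc q-1)) → let r = mkℚ (+ p) q-1 c in ℕtoℚ 2 ℚ.< r ℚ.* r → 2 * (suc q-1 * suc q-1) < p * p
2<r² p q-1 c h with ℚᵘ.<-respʳ-≃ (ℚ.toℚᵘ-homo-* r r) (ℚ.toℚᵘ-mono-< h)
  where r = mkℚ (+ p) q-1 c
... | *<* h′ = ℤ.drop‿+<+ (subst₂ ℤ._<_ (sym (ℤ.pos-* 2 (suc q-1 * suc q-1))) (trans (ℤ.*-identityʳ _) (sym (ℤ.pos-* p p))) h′)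

r²<2 : ∀ p q-1 .(c : Coprime p (suc q-1)) → let r = mkℚ (+ p) q-1 c in r ℚ.* r ℚ.< ℕtoℚ 2 → p * p < 2 * (suc q-1 * suc q-1)
r²<2 p q-1 c h with ℚᵘ.<-respˡ-≃ (ℚ.toℚᵘ-homo-* r r) (ℚ.toℚᵘ-mono-< h)
  where r = mkℚ (+ p) q-1 c
... | *<* h′ = ℤ.drop‿+<+ (subst₂ ℤ._<_ (trans (ℤ.*-identityʳ _) (sym (ℤ.pos-* p p))) (sym (ℤ.pos-* 2 (suc q-1 * suc q-1))) h′)

cube-≤ : ∀ α a-1 .(c : Coprime ∣ α ∣ (suc a-1)) n m → α ℤ.* + (n * n * n) ℤ.≤ + (suc a-1 * m) →
  mkℚ α a-1 c ℚ.* (ℕtoℚ n ℚ.* ℕtoℚ n ℚ.* ℕtoℚ n) ℚ.≤ ℕtoℚ m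
cube-≤ α a-1 c n m h = ℚ.toℚᵘ-cancel-≤ (ℚᵘ.≤-respˡ-≃ (ℚᵘ.≃-sym (toℚᵘ-cube (mkℚ α a-1 c) n))
  (ℚᵘ.≤-respʳ-≃ (ℚᵘ.≃-sym (toℚᵘ-ℕ m)) (*≤* (subst₂ ℤ._≤_ (sym (ℤ.*-identityʳ _)) eq h))))
  where
  eq : + (suc a-1 * m) ≡ + m ℤ.* + (suc a-1 * 1)
  eq = trans (cong +_ (trans (*-comm (suc a-1) m) (cong (λ x → m * x) (sym (*-identityʳ (suc a-1)))))) (ℤ.pos-* m (suc a-1 * 1))

cube-≥ : ∀ α a-1 .(c : Coprime ∣ α ∣ (suc a-1)) n m → + (suc a-1 * m) ℤ.≤ α ℤ.* + (n * n * n) →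
  ℕtoℚ m ℚ.≤ mkℚ α a-1 c ℚ.* (ℕtoℚ n ℚ.* ℕtoℚ n ℚ.* ℕtoℚ n)
cube-≥ α a-1 c n m h = ℚ.toℚᵘ-cancel-≤ (ℚᵘ.≤-respʳ-≃ (ℚᵘ.≃-sym (toℚᵘ-cube (mkℚ α a-1 c) n))
  (ℚᵘ.≤-respˡ-≃ (ℚᵘ.≃-sym (toℚᵘ-ℕ m)) (*≤* (subst₂ ℤ._≤_ eq (sym (ℤ.*-identityʳ _)) h))))
  where
  eq : + (suc a-1 * m) ≡ + m ℤ.* + (suc a-1 * 1)
  eq = trans (cong +_ (trans (*-comm (suc a-1) m) (cong (λ x → m * x) (sym (*-identityʳ (suc a-1)))))) (ℤ.pos-* m (suc a-1 * 1))

-- Absorbing the quadratic error for large n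

lower-scale : ∀ α a D Q n μ .{{_ : NonZero D}} → 12 * α * (D * D) < a * Q → 11 * a * (D * D) ≤ n →
  2 * (Q * (n * n * n)) ≤ D * D * (24 * μ + 11 * (n * n)) → α * (n * n * n) ≤ a * μ
lower-scale α a D@(suc _) Q n μ h n≥ b = *-cancelˡ-≤ (24 * (D * D)) (+-cancelʳ-≤ (2 * (n * n * n)) _ _ (begin
  24 * (D * D) * (α * (n * n * n)) + 2 * (n * n * n)   ≡⟨ lem₁ α (D * D) (n * n * n) ⟩
  -- A strict inequality of integers gains 1, which yields 2 n³ and outweighs the error 11 a D² n²
  -- once n ≥ 11 a D².
  2 * (suc (12 * α * (D * D)) * (n * n * n))           ≤⟨ *-monoʳ-≤ 2 (*-monoˡ-≤ (n * n * n) h) ⟩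
  2 * (a * Q * (n * n * n))                            ≡⟨ lem₂ a Q (n * n * n) ⟩
  a * (2 * (Q * (n * n * n)))                          ≤⟨ *-monoʳ-≤ a b ⟩
  a * (D * D * (24 * μ + 11 * (n * n)))                ≡⟨ lem₃ a (D * D) μ (n * n) ⟩
  24 * (D * D) * (a * μ) + n * n * (11 * a * (D * D))  ≤⟨ +-monoʳ-≤ (24 * (D * D) * (a * μ)) (≤-trans (*-monoʳ-≤ (n * n) n≥) (m≤m+n (n * n * n) _)) ⟩
  24 * (D * D) * (a * μ) + 2 * (n * n * n)             ∎))
  where
  open ≤-Reasoning
  lem₁ : ∀ α d c → 24 * d * (α * c) + 2 * c ≡ 2 * ((1 + 12 * α * d) * c)
  lem₁ = solve-∀
  lem₂ : ∀ a Q c → 2 * (a * Q * c) ≡ a * (2 * (Q * c))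
  lem₂ = solve-∀
  lem₃ : ∀ a d μ s → a * (d * (24 * μ + 11 * s)) ≡ 24 * d * (a * μ) + s * (11 * a * d)
  lem₃ = solve-∀

upper-scale : ∀ β b D Q C n μ .{{_ : NonZero D}} → b * Q < 12 * β * (D * D) → b * C ≤ n →
  12 * (D * D * D) * μ ≤ D * Q * (n * n * n) + C * (n * n) → b * μ ≤ β * (n * n * n)
upper-scale β b D@(suc d) Q C n μ h n≥ u = *-cancelˡ-≤ (12 * (D * D * D)) (begin
  12 * (D * D * D) * (b * μ)                           ≡⟨ lem₁ (12 * (D * D * D)) b μ ⟩
  b * (12 * (D * D * D) * μ)                           ≤⟨ *-monoʳ-≤ b u ⟩
  b * (D * Q * (n * n * n) + C * (n * n))              ≡⟨ lem₂ b D Q (n * n * n) C (n * n) ⟩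
  D * (b * Q * (n * n * n)) + n * n * (b * C)          ≤⟨ +-monoʳ-≤ (D * (b * Q * (n * n * n))) (≤-trans (*-monoʳ-≤ (n * n) n≥) (m≤m+n (n * n * n) _)) ⟩
  D * (b * Q * (n * n * n)) + D * (n * n * n)          ≡⟨ lem₃ D (b * Q) (n * n * n) ⟩
  -- The gain from strictness is D n³, which has absorbed b C n².
  D * (suc (b * Q) * (n * n * n))                      ≤⟨ *-monoʳ-≤ D (*-monoˡ-≤ (n * n * n) h) ⟩
  D * (12 * β * (D * D) * (n * n * n))                 ≡⟨ lem₄ D β (n * n * n) ⟩
  12 * (D * D * D) * (β * (n * n * n))                 ∎)
  where
  open ≤-Reasoning
  lem₁ : ∀ x b μ → x * (b * μ) ≡ b * (x * μ)
  lem₁ = solve-∀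
  lem₂ : ∀ b D Q c C s → b * (D * Q * c + C * s) ≡ D * (b * Q * c) + s * (b * C)
  lem₂ = solve-∀
  lem₃ : ∀ D x c → D * (x * c) + D * c ≡ D * ((1 + x) * c)
  lem₃ = solve-∀
  lem₄ : ∀ D β c → D * (12 * β * (D * D) * c) ≡ 12 * (D * D * D) * (β * c)
  lem₄ = solve-∀

m*[12*n]≡12*m*n : ∀ α d → α * (12 * d) ≡ 12 * α * d
m*[12*n]≡12*m*n = solve-∀

eventually-above : ∀ κ a → BelowC a → ∃ λ N → ∀ n → n ≥ N →
  a ℚ.* (ℕtoℚ n ℚ.* ℕtoℚ n ℚ.* ℕtoℚ n) ℚ.≤ ℕtoℚ (M -[1+ suc κ ] n)
eventually-above κ a@record{} (mkℚ -[1+ _ ] _ _ , ℚ.*≤* () , _)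
-- A negative multiple of n³ lies below every natural number, so N = 0 works.
eventually-above κ (mkℚ -[1+ α ] a-1 c) (mkℚ (+ p) q-1 c′ , _) = 0 , λ n _ →
  cube-≤ -[1+ α ] a-1 c n (M -[1+ suc κ ] n) (ℤ.≤-trans (ℤ.*-monoʳ-≤-nonNeg (+ (n * n * n)) (ℤ.-≤+ {α} {0})) (ℤ.+≤+ z≤n))
eventually-above κ (mkℚ (+ α) a-1 c) (mkℚ (+ p) q-1 c′ , _ , r²>2 , below) =
  -- The `suc` guarantees n ≥ 1.
  suc (11 * suc a-1 * (D * D)) , λ n n≥ → cube-≤ (+ α) a-1 c n (M k n)
    (subst (λ x → x ℤ.≤ + (suc a-1 * M k n)) (ℤ.pos-* α (n * n * n)) (ℤ.+≤+
      (lower-scale α (suc a-1) D (q * q) n (M k n) 12αD²<aq² (≤-trans (n≤1+n _) n≥)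
        (M-lower-bound κ n p q {{p≢0 p 2q²<p²}} (≤-trans (s≤s z≤n) n≥) (<⇒≤ 2q²<p²)))))
  where
  k = -[1+ suc κ ]
  q = suc q-1
  D = q + 2 * p
  2q²<p² : 2 * (q * q) < p * p
  2q²<p² = 2<r² p q-1 c′ r²>2
  p≢0 : ∀ p {x} → x < p * p → NonZero p
  p≢0 (suc _) _ = _
  12αD²<aq² : 12 * α * (D * D) < suc a-1 * (q * q)
  12αD²<aq² = subst (λ x → x < suc a-1 * (q * q)) (m*[12*n]≡12*m*n α (D * D))
    (ℤ.drop‿+<+ (subst (λ x → x ℤ.< + (suc a-1 * (q * q))) (sym (ℤ.pos-* α (12 * (D * D)))) (den-below (+ α) a-1 c p q-1 c′ below)))

eventually-below : ∀ κ b → AboveC b → ∃ λ N → ∀ n → n ≥ N →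
  ℕtoℚ (M -[1+ suc κ ] n) ℚ.≤ b ℚ.* (ℕtoℚ n ℚ.* ℕtoℚ n ℚ.* ℕtoℚ n)
eventually-below κ b@record{} (mkℚ -[1+ _ ] _ _ , ℚ.*≤* () , _)
eventually-below κ (mkℚ β b-1 c) (mkℚ (+ p) q-1 c′ , _ , r²<2′ , above) = go β (den-above β b-1 c p q-1 c′ above)
  where
  k = -[1+ suc κ ]
  q = suc q-1
  D = q + 2 * p
  go : ∀ β .{c : Coprime ∣ β ∣ (suc b-1)} → + (suc b-1 * (q * q)) ℤ.< β ℤ.* + (12 * (D * D)) → ∃ λ N → ∀ n → n ≥ N →
    ℕtoℚ (M k n) ℚ.≤ mkℚ β b-1 c ℚ.* (ℕtoℚ n ℚ.* ℕtoℚ n ℚ.* ℕtoℚ n)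
  -- The hypothesis makes b positive, so a negative numerator is absurd.
  go -[1+ β ] {c} ()
  go (+ β) {c} h =
    let C , bound = M-upper-bound κ p q (<⇒≤ (r²<2 p q-1 c′ r²<2′)) in
    suc (suc b-1 * C) , λ n n≥ → cube-≥ (+ β) b-1 c n (M k n)
      (subst (λ x → + (suc b-1 * M k n) ℤ.≤ x) (ℤ.pos-* β (n * n * n)) (ℤ.+≤+
        (upper-scale β (suc b-1) D (q * q) C n (M k n) bq²<12βD² (≤-trans (n≤1+n _) n≥)
          (bound n (≤-trans (s≤s z≤n) n≥)))))
    where
    bq²<12βD² : suc b-1 * (q * q) < 12 * β * (D * D)
    bq²<12βD² = subst (λ x → suc b-1 * (q * q) < x) (m*[12*n]≡12*m*n β (D * D))
      (ℤ.drop‿+<+ (subst (λ x → + (suc b-1 * (q * q)) ℤ.< x) (sym (ℤ.pos-* β (12 * (D * D)))) h))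

-- As c > 0, having a n³ ≤ M k n ≤ b n³ from some n on, for all rationals a < c < b, says that M k n
-- / (c n³) tends to 1.
theorem5p1 : (k : ℤ) → k ℤ.≤ -[1+ 1 ] →
    (a b : ℚ) → BelowC a → AboveC b →
    ∃ λ N → (n : ℕ) → n ≥ N →
    (a ℚ.* (ℕtoℚ n ℚ.* ℕtoℚ n ℚ.* ℕtoℚ n) ℚ.≤ ℕtoℚ (M k n))
    × (ℕtoℚ (M k n) ℚ.≤ b ℚ.* (ℕtoℚ n ℚ.* ℕtoℚ n ℚ.* ℕtoℚ n))
-- The condition k ≤ -2 means exactly that k = -(2 + κ) for a natural number κ.
theorem5p1 -[1+ suc κ ] (ℤ.-≤- _) a b below above =
  let N₁ , above′ = eventually-above κ a below
      N₂ , below′ = eventually-below κ b above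
  in N₁ + N₂ , λ n n≥ → above′ n (≤-trans (m≤m+n N₁ N₂) n≥) , below′ n (≤-trans (m≤n+m N₂ N₁) n≥)
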